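{- Let $n \ge 1$ be an integer, let $A \subseteq \{ -1,1\}^n$ have density $\alpha = \frac{|A|}{2^n}$, and let $f = 1_A : \{ -1,1\}^n \to \mathbb{R}$ be the characteristic function of $A$, i.e. $f(x) = 1$ if $x \in A$ and $f(x) = 0$ if $x \notin A$. Then $$\sum_{i=1}^n \widehat{f}(\{i\})^2 \le 2 \alpha^2 \ln \frac{1}{\alpha}.$$
   Context: For a function $f : \{ -1,1\}^n \to \mathbb{R}$ and $S \subseteq [n] = \{1,\dots,n\}$, the Fourier coefficient of $f$ at $S$ is $\widehat{f}(S) = \mathbb{E}_{x}[f(x)\chi_S(x)] = 2^{ -n}\sum_{x \in \{ -1,1\}^n} f(x)\chi_S(x)$, where $x$ is uniformly distributed on $\{ -1,1\}^n$ and $\chi_S(x) = \prod_{i \in S} x_i$. In particular $\widehat{f}(\{i\}) = \mathbb{E}_x[f(x) x_i]$. Here $\ln$ is the natural logarithm. If $\alpha = 0$, the right-hand side $2\alpha^2 \ln(1/\alpha)$ is interpreted as $0$. -}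

module Defs where

open import Data.Bool.Base using (if_then_else_)
open import Data.Fin.Base using (Fin)
open import Data.Fin.Subset using (Subset)
open import Data.Fin.Subset.Properties using (_∈?_)
open import Data.Integer.Base as ℤ using (ℤ; +_; -[1+_])
import Data.Integer.Properties as ℤ
open import Data.List.Base as List
  using (List; []; _∷_; allFin; applyUpTo; cartesianProductWith; filter; foldr; length; map)
open import Data.Nat.Base as ℕ using (ℕ; zero; suc)
import Data.Nat.Properties as ℕ
open import Data.Product.Base using (_×_; _,_; ∃; proj₁; proj₂)
open import Data.Rational.Base
open import Data.Rational.Properties
open import Data.Rational.Solver
import Data.Rational.Unnormalised.Base as ℚᵘ
import Data.Rational.Unnormalised.Properties as ℚᵘ
open import Data.Sign.Base as Sign using (Sign)
open import Data.Sum.Base using (inj₁; inj₂)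
open import Data.Vec.Base using (Vec; []; _∷_; lookup)
open import Function.Base using (_∘_)
open import Level using (0ℓ)
open import Relation.Binary.PropositionalEquality
open import Relation.Nullary.Decidable.Core using (yes; no; does)
open import Relation.Nullary.Negation.Core using (contradiction)
open import Relation.Unary using (Pred; Decidable)

open +-*-Solver using (solve; _:=_; _:+_; _:*_; _:-_; :-_; con)

private
  variable
    X : Set

-- Cauchy reals. The order and the operations only depend on the limit of the
-- sequence, so no quotient is taken.

IsCauchy : (ℕ → ℚ) → Set
IsCauchy x = ∀ ε → 0ℚ < ε → ∃ λ N → ∀ m n → N ℕ.≤ m → N ℕ.≤ n → ∣ x m - x n ∣ ≤ ε

record ℝ : Set where
  constructor mkℝ
  field
    seq    : ℕ → ℚ
    cauchy : IsCauchy seq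

open ℝ public

infix 4 _≤ℝ_

-- lim x ≤ lim y. Requiring seq x n ≤ seq y n eventually would be too strong.
_≤ℝ_ : ℝ → ℝ → Set
x ≤ℝ y = ∀ ε → 0ℚ < ε → ∃ λ N → ∀ n → N ℕ.≤ n → seq x n ≤ seq y n + ε

module ℚ-Lemmas where

  0≤∣_∣ : ∀ p → 0ℚ ≤ ∣ p ∣
  0≤∣ p ∣ = 0≤∣p∣ p

  *-mono-≤-nonNeg : ∀ {a b c d} → 0ℚ ≤ a → 0ℚ ≤ c → a ≤ b → c ≤ d → a * c ≤ b * d
  *-mono-≤-nonNeg {a} {b} {c} {d} 0≤a 0≤c a≤b c≤d = ≤-trans
    (*-monoʳ-≤-nonNeg c {{nonNegative 0≤c}} a≤b)
    (*-monoˡ-≤-nonNeg b {{nonNegative (≤-trans 0≤a a≤b)}} c≤d)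

  0≤* : ∀ {a b} → 0ℚ ≤ a → 0ℚ ≤ b → 0ℚ ≤ a * b
  0≤* {a} {b} 0≤a 0≤b =
    subst (_≤ a * b) (*-zeroˡ 0ℚ) (*-mono-≤-nonNeg ≤-refl ≤-refl 0≤a 0≤b)

  0<* : ∀ {a b} → 0ℚ < a → 0ℚ < b → 0ℚ < a * b
  0<* {a} {b} 0<a 0<b =
    positive⁻¹ (a * b) {{pos*pos⇒pos a {{positive 0<a}} b {{positive 0<b}}}}

  ∣p-q∣≡∣q-p∣ : ∀ p q → ∣ p - q ∣ ≡ ∣ q - p ∣
  ∣p-q∣≡∣q-p∣ p q = trans
    (cong ∣_∣ (solve 2 (λ p q → p :- q := :- (q :- p)) refl p q))
    (∣-p∣≡∣p∣ (q - p))

  triangle : ∀ p q r → ∣ p - r ∣ ≤ ∣ p - q ∣ + ∣ q - r ∣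
  triangle p q r = subst (λ z → ∣ z ∣ ≤ ∣ p - q ∣ + ∣ q - r ∣)
    (solve 3 (λ p q r → (p :- q) :+ (q :- r) := p :- r) refl p q r)
    (∣p+q∣≤∣p∣+∣q∣ (p - q) (q - r))

  halves : ∀ ε → ε * ½ + ε * ½ ≡ ε
  halves = solve 1 (λ ε → ε :* con ½ :+ ε :* con ½ := ε) refl

  0<½* : ∀ {ε} → 0ℚ < ε → 0ℚ < ε * ½
  0<½* 0<ε = 0<* 0<ε (positive⁻¹ ½)

open ℚ-Lemmas

fromℚ : ℚ → ℝ
fromℚ q = mkℝ (λ _ → q) λ ε 0<ε → 0 , λ _ _ _ _ →
  ≤-trans (≤-reflexive (cong ∣_∣ (+-inverseʳ q))) (<⇒≤ 0<ε)

0ℝ 1ℝ : ℝ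
0ℝ = fromℚ 0ℚ
1ℝ = fromℚ 1ℚ

infixl 6 _+ℝ_
infixl 7 _*ℝ_
infixr 8 _²

_+ℝ_ : ℝ → ℝ → ℝ
x +ℝ y = mkℝ (λ n → seq x n + seq y n) isCauchy
  where
  isCauchy : IsCauchy (λ n → seq x n + seq y n)
  isCauchy ε 0<ε with cauchy x (ε * ½) (0<½* 0<ε) | cauchy y (ε * ½) (0<½* 0<ε)
  ... | M , xM | N , yN = M ℕ.+ N , λ m n m≥ n≥ → begin
    ∣ (seq x m + seq y m) - (seq x n + seq y n) ∣
      ≡⟨ cong ∣_∣ (solve 4 (λ a b c d → (a :+ b) :- (c :+ d) := (a :- c) :+ (b :- d))
           refl (seq x m) (seq y m) (seq x n) (seq y n)) ⟩
    ∣ (seq x m - seq x n) + (seq y m - seq y n) ∣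
      ≤⟨ ∣p+q∣≤∣p∣+∣q∣ (seq x m - seq x n) (seq y m - seq y n) ⟩
    ∣ seq x m - seq x n ∣ + ∣ seq y m - seq y n ∣
      ≤⟨ +-mono-≤ (xM m n (ℕ.m+n≤o⇒m≤o M m≥) (ℕ.m+n≤o⇒m≤o M n≥))
                  (yN m n (ℕ.m+n≤o⇒n≤o M m≥) (ℕ.m+n≤o⇒n≤o M n≥)) ⟩
    ε * ½ + ε * ½
      ≡⟨ halves ε ⟩
    ε ∎
    where open ≤-Reasoning

module ℝ-Lemmas where

  -- An eventual bound on the absolute values of a Cauchy sequence.
  bounded : ∀ x → ∃ λ B → 0ℚ < B × ∃ λ N → ∀ n → N ℕ.≤ n → ∣ seq x n ∣ ≤ B
  bounded x with cauchy x 1ℚ (positive⁻¹ 1ℚ)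
  ... | N , xN = ∣ seq x N ∣ + 1ℚ
    , +-mono-≤-< {0ℚ} {∣ seq x N ∣} 0≤∣ seq x N ∣ (positive⁻¹ 1ℚ)
    , N , λ n n≥ → begin
    ∣ seq x n ∣
      ≡⟨ cong ∣_∣ (solve 2 (λ a b → a := b :+ (a :- b)) refl (seq x n) (seq x N)) ⟩
    ∣ seq x N + (seq x n - seq x N) ∣
      ≤⟨ ∣p+q∣≤∣p∣+∣q∣ (seq x N) (seq x n - seq x N) ⟩
    ∣ seq x N ∣ + ∣ seq x n - seq x N ∣
      ≤⟨ +-monoʳ-≤ ∣ seq x N ∣ (xN n N n≥ ℕ.≤-refl) ⟩
    ∣ seq x N ∣ + 1ℚ ∎
    where open ≤-Reasoning

  share : ∀ ε B → 0ℚ < ε → 0ℚ < B → ∃ λ δ → 0ℚ < δ × B * δ ≡ ε * ½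
  share ε B 0<ε 0<B = ε * ½ * 1/ B
    , 0<* (0<½* 0<ε) (positive⁻¹ (1/ B) {{1/pos⇒pos B {{positive 0<B}}}})
    , (begin
    B * (ε * ½ * 1/ B)   ≡⟨ solve 3 (λ b e b′ → b :* (e :* b′) := e :* (b :* b′)) refl B (ε * ½) (1/ B) ⟩
    ε * ½ * (B * 1/ B)   ≡⟨ cong (ε * ½ *_) (*-inverseʳ B) ⟩
    ε * ½ * 1ℚ           ≡⟨ *-identityʳ (ε * ½) ⟩
    ε * ½                ∎)
    where
    open ≡-Reasoning
    instance
      B≢0 = pos⇒nonZero B {{positive 0<B}}

  *-dist : ∀ {B C δ γ} a b c d → ∣ a ∣ ≤ B → ∣ d ∣ ≤ C → ∣ b - d ∣ ≤ γ → ∣ a - c ∣ ≤ δ →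
           ∣ a * b - c * d ∣ ≤ B * γ + C * δ
  *-dist {B} {C} {δ} {γ} a b c d a≤ d≤ bd≤ ac≤ = begin
    ∣ a * b - c * d ∣
      ≡⟨ cong ∣_∣ (solve 4 (λ a b c d → a :* b :- c :* d := a :* (b :- d) :+ d :* (a :- c))
           refl a b c d) ⟩
    ∣ a * (b - d) + d * (a - c) ∣
      ≤⟨ ∣p+q∣≤∣p∣+∣q∣ (a * (b - d)) (d * (a - c)) ⟩
    ∣ a * (b - d) ∣ + ∣ d * (a - c) ∣
      ≡⟨ cong₂ _+_ (∣p*q∣≡∣p∣*∣q∣ a (b - d)) (∣p*q∣≡∣p∣*∣q∣ d (a - c)) ⟩
    ∣ a ∣ * ∣ b - d ∣ + ∣ d ∣ * ∣ a - c ∣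
      ≤⟨ +-mono-≤ (*-mono-≤-nonNeg 0≤∣ a ∣ 0≤∣ b - d ∣ a≤ bd≤)
                  (*-mono-≤-nonNeg 0≤∣ d ∣ 0≤∣ a - c ∣ d≤ ac≤) ⟩
    B * γ + C * δ ∎
    where open ≤-Reasoning

open ℝ-Lemmas

_*ℝ_ : ℝ → ℝ → ℝ
x *ℝ y = mkℝ (λ n → seq x n * seq y n) isCauchy
  where
  isCauchy : IsCauchy (λ n → seq x n * seq y n)
  isCauchy ε 0<ε =
    let B , 0<B , K , x≤B = bounded x
        C , 0<C , L , y≤C = bounded y
        γ , 0<γ , Bγ      = share ε B 0<ε 0<B
        δ , 0<δ , Cδ      = share ε C 0<ε 0<C
        M , xM            = cauchy x δ 0<δ
        N , yN            = cauchy y γ 0<γ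
    in (K ℕ.⊔ L) ℕ.⊔ (M ℕ.⊔ N) , λ m n m≥ n≥ →
      let m≥KL = ℕ.m⊔n≤o⇒m≤o (K ℕ.⊔ L) (M ℕ.⊔ N) m≥
          n≥KL = ℕ.m⊔n≤o⇒m≤o (K ℕ.⊔ L) (M ℕ.⊔ N) n≥
          m≥MN = ℕ.m⊔n≤o⇒n≤o (K ℕ.⊔ L) (M ℕ.⊔ N) m≥
          n≥MN = ℕ.m⊔n≤o⇒n≤o (K ℕ.⊔ L) (M ℕ.⊔ N) n≥
      in ≤-trans
        (*-dist (seq x m) (seq y m) (seq x n) (seq y n)
          (x≤B m (ℕ.m⊔n≤o⇒m≤o K L m≥KL))
          (y≤C n (ℕ.m⊔n≤o⇒n≤o K L n≥KL))
          (yN m n (ℕ.m⊔n≤o⇒n≤o M N m≥MN) (ℕ.m⊔n≤o⇒n≤o M N n≥MN))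
          (xM m n (ℕ.m⊔n≤o⇒m≤o M N m≥MN) (ℕ.m⊔n≤o⇒m≤o M N n≥MN)))
        (≤-reflexive (trans (cong₂ _+_ Bγ Cδ) (halves ε)))

_² : ℝ → ℝ
x ² = x *ℝ x

∑ : List X → (X → ℝ) → ℝ
∑ xs f = foldr _+ℝ_ 0ℝ (map f xs)

∏ : List X → (X → ℝ) → ℝ
∏ xs f = foldr _*ℝ_ 1ℝ (map f xs)

-- Total reciprocal, with 0 ⁻¹ = 0.
infix 8 _⁻¹

_⁻¹ : ℚ → ℚ
p ⁻¹ with p ≟ 0ℚ
... | yes _   = 0ℚ
... | no  p≢0 = (1/ p) {{≢-nonZero p≢0}}

∑< : ℕ → (ℕ → ℚ) → ℚ
∑< n f = foldr _+_ 0ℚ (applyUpTo f n)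

-- Left Riemann sum of f from a to b with n equal steps.
riemann : (ℚ → ℚ) → ℚ → ℚ → (n : ℕ) .{{_ : ℕ.NonZero n}} → ℚ
riemann f a b n = ∑< n λ k → f (a + (+ k / n) * (b - a)) * ((b - a) * (+ 1 / n))

module ∑<-Lemmas where

  -- Abstract because conversion checking is very slow when it unfolds normalised fractions.
  abstract
    ι : ℕ → ℚ
    ι n = + n / 1

    r : ℕ → ℚ
    r n = + 1 / suc n

    r≡ : ∀ n → + 1 / suc n ≡ r n
    r≡ n = refl

    ι0≡0 : ι 0 ≡ 0ℚ
    ι0≡0 = refl

    via-ℚᵘ : ∀ {p q} → toℚᵘ p ℚᵘ.≃ toℚᵘ q → p ≡ q
    via-ℚᵘ = toℚᵘ-injective

    toℚᵘ-/ : ∀ i n → toℚᵘ (i / suc n) ℚᵘ.≃ ℚᵘ.mkℚᵘ i n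
    toℚᵘ-/ i n = toℚᵘ-fromℚᵘ (ℚᵘ.mkℚᵘ i n)

    -- k / (n + 1) ≡ k · 1 / (n + 1)
    /≡ι*r : ∀ k n → + k / suc n ≡ ι k * r n
    /≡ι*r k n = via-ℚᵘ (begin
      toℚᵘ (+ k / suc n)               ≈⟨ toℚᵘ-/ (+ k) n ⟩
      ℚᵘ.mkℚᵘ (+ k) n                  ≈⟨ ℚᵘ.*≡* eq ⟩
      ℚᵘ.mkℚᵘ (+ k) 0 ℚᵘ.* ℚᵘ.mkℚᵘ (+ 1) n ≈⟨ ℚᵘ.*-cong (toℚᵘ-/ (+ k) 0) (toℚᵘ-/ (+ 1) n) ⟨
      toℚᵘ (ι k) ℚᵘ.* toℚᵘ (r n)       ≈⟨ toℚᵘ-homo-* (ι k) (r n) ⟨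
      toℚᵘ (ι k * r n)                 ∎)
      where
      open ℚᵘ.≃-Reasoning
      eq : + k ℤ.* (+ 1 ℤ.* + suc n) ≡ (+ k ℤ.* + 1) ℤ.* + suc n
      eq = sym (ℤ.*-assoc (+ k) (+ 1) (+ suc n))

    ι-+ : ∀ m n → ι (m ℕ.+ n) ≡ ι m + ι n
    ι-+ m n = via-ℚᵘ (begin
      toℚᵘ (ι (m ℕ.+ n))               ≈⟨ toℚᵘ-/ (+ (m ℕ.+ n)) 0 ⟩
      ℚᵘ.mkℚᵘ (+ (m ℕ.+ n)) 0          ≈⟨ ℚᵘ.*≡* (cong (ℤ._* + 1) eq) ⟩
      ℚᵘ.mkℚᵘ (+ m) 0 ℚᵘ.+ ℚᵘ.mkℚᵘ (+ n) 0 ≈⟨ ℚᵘ.+-cong (toℚᵘ-/ (+ m) 0) (toℚᵘ-/ (+ n) 0) ⟨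
      toℚᵘ (ι m) ℚᵘ.+ toℚᵘ (ι n)       ≈⟨ toℚᵘ-homo-+ (ι m) (ι n) ⟨
      toℚᵘ (ι m + ι n)                 ∎)
      where
      open ℚᵘ.≃-Reasoning
      eq : + (m ℕ.+ n) ≡ + m ℤ.* + 1 ℤ.+ + n ℤ.* + 1
      eq = sym (cong₂ ℤ._+_ (ℤ.*-identityʳ (+ m)) (ℤ.*-identityʳ (+ n)))

    ι-suc : ∀ n → ι (suc n) ≡ 1ℚ + ι n
    ι-suc n = ι-+ 1 n

    ι-* : ∀ m n → ι (m ℕ.* n) ≡ ι m * ι n
    ι-* zero    n = sym (*-zeroˡ (ι n))
    ι-* (suc m) n = begin
      ι (n ℕ.+ m ℕ.* n)   ≡⟨ ι-+ n (m ℕ.* n) ⟩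
      ι n + ι (m ℕ.* n)   ≡⟨ cong (λ z → ι n + z) (ι-* m n) ⟩
      ι n + ι m * ι n     ≡⟨ solve 2 (λ m n → n :+ m :* n := (con 1ℚ :+ m) :* n) refl (ι m) (ι n) ⟩
      (1ℚ + ι m) * ι n    ≡⟨ cong (_* ι n) (ι-suc m) ⟨
      ι (suc m) * ι n     ∎
      where open ≡-Reasoning

    0≤ι : ∀ n → 0ℚ ≤ ι n
    0≤ι n = nonNegative⁻¹ (ι n) {{normalize-nonNeg n 1}}

    ι-mono : ∀ {m n} → m ℕ.≤ n → ι m ≤ ι n
    ι-mono {m} {n} m≤n = begin
      ι m                  ≡⟨ +-identityʳ (ι m) ⟨
      ι m + 0ℚ             ≤⟨ +-monoʳ-≤ (ι m) (0≤ι (n ℕ.∸ m)) ⟩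
      ι m + ι (n ℕ.∸ m)    ≡⟨ ι-+ m (n ℕ.∸ m) ⟨
      ι (m ℕ.+ (n ℕ.∸ m))  ≡⟨ cong ι (ℕ.m+[n∸m]≡n m≤n) ⟩
      ι n                  ∎
      where open ≤-Reasoning

    0≤r : ∀ n → 0ℚ ≤ r n
    0≤r n = nonNegative⁻¹ (r n) {{normalize-nonNeg 1 (suc n)}}

    ι*r : ∀ n → ι (suc n) * r n ≡ 1ℚ
    ι*r n = trans (sym (/≡ι*r (suc n) n))
      (via-ℚᵘ (ℚᵘ.≃-trans (toℚᵘ-/ (+ suc n) n) (ℚᵘ.*≡* (ℤ.*-comm (+ suc n) (+ 1)))))

    archimedean : ∀ q → ∃ λ N → q ≤ ι N
    archimedean q = ℤ.∣ ↥ q ∣ , toℚᵘ-cancel-≤ (ℚᵘ.≤-respʳ-≃ (ℚᵘ.≃-sym (toℚᵘ-/ (+ ℤ.∣ ↥ q ∣) 0)) (lemma q))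
      where
      i≤∣i∣ : ∀ i → i ℤ.≤ + ℤ.∣ i ∣
      i≤∣i∣ (+ n)    = ℤ.≤-refl
      i≤∣i∣ -[1+ n ] = ℤ.-≤+
      lemma : ∀ q → toℚᵘ q ℚᵘ.≤ ℚᵘ.mkℚᵘ (+ ℤ.∣ ↥ q ∣) 0
      lemma q@record{} = ℚᵘ.*≤* (ℤ.≤-trans (ℤ.≤-reflexive (ℤ.*-identityʳ (↥ q)))
        (ℤ.≤-trans (i≤∣i∣ (↥ q))
          (ℤ.≤-trans (ℤ.≤-reflexive (sym (ℤ.*-identityʳ (+ ℤ.∣ ↥ q ∣))))
            (ℤ.*-monoˡ-≤-nonNeg (+ ℤ.∣ ↥ q ∣) (ℤ.+≤+ (ℕ.s≤s ℕ.z≤n))))))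

  K*r-small : ∀ K ε → 0ℚ < ε → ∃ λ N → ∀ n → N ℕ.≤ n → K * r n ≤ ε
  K*r-small K ε 0<ε with archimedean (K * (1/ ε) {{pos⇒nonZero ε {{positive 0<ε}}}})
  ... | N , K/ε≤N = N , λ n N≤n →
    bound (ι (suc n)) (r n) (ι*r n) (0≤r n) (≤-trans K/ε≤N (ι-mono (ℕ.m≤n⇒m≤1+n N≤n)))
    where
    open ≤-Reasoning
    instance
      ε≢0 = pos⇒nonZero ε {{positive 0<ε}}
    bound : ∀ i s → i * s ≡ 1ℚ → 0ℚ ≤ s → K * 1/ ε ≤ i → K * s ≤ ε
    bound i s is≡1 0≤s K/ε≤i = begin
      K * s                  ≡⟨ cong (_* s) (*-identityʳ K) ⟨
      K * 1ℚ * s             ≡⟨ cong (λ z → K * z * s) (*-inverseˡ ε) ⟨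
      K * (1/ ε * ε) * s     ≡⟨ cong (_* s) (*-assoc K (1/ ε) ε) ⟨
      K * 1/ ε * ε * s       ≤⟨ *-monoʳ-≤-nonNeg s {{nonNegative 0≤s}}
                                  (*-monoʳ-≤-nonNeg ε {{nonNegative (<⇒≤ 0<ε)}} K/ε≤i) ⟩
      i * ε * s              ≡⟨ solve 3 (λ i e s → i :* e :* s := e :* (i :* s)) refl i ε s ⟩
      ε * (i * s)            ≡⟨ cong (ε *_) is≡1 ⟩
      ε * 1ℚ                 ≡⟨ *-identityʳ ε ⟩
      ε                      ∎

  ∑<-cong : ∀ n {f g : ℕ → ℚ} → (∀ k → f k ≡ g k) → ∑< n f ≡ ∑< n g
  ∑<-cong zero    eq = refl
  ∑<-cong (suc n) eq = cong₂ _+_ (eq 0) (∑<-cong n (eq ∘ suc))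

  ∑<-const : ∀ n c → ∑< n (λ _ → c) ≡ ι n * c
  ∑<-const zero    c = sym (trans (cong (_* c) ι0≡0) (*-zeroˡ c))
  ∑<-const (suc n) c = begin
    c + ∑< n (λ _ → c)  ≡⟨ cong (λ z → c + z) (∑<-const n c) ⟩
    c + ι n * c         ≡⟨ solve 2 (λ c i → c :+ i :* c := (con 1ℚ :+ i) :* c) refl c (ι n) ⟩
    (1ℚ + ι n) * c      ≡⟨ cong (_* c) (ι-suc n) ⟨
    ι (suc n) * c       ∎
    where open ≡-Reasoning

  ∑<-++ : ∀ m n f → ∑< (m ℕ.+ n) f ≡ ∑< m f + ∑< n (λ k → f (m ℕ.+ k))
  ∑<-++ zero    n f = sym (+-identityˡ (∑< n f))
  ∑<-++ (suc m) n f = trans (cong (λ z → f 0 + z) (∑<-++ m n (f ∘ suc))) (sym (+-assoc (f 0) _ _))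

  ∑<-blocks : ∀ n m f → ∑< (n ℕ.* m) f ≡ ∑< n λ k → ∑< m λ j → f (k ℕ.* m ℕ.+ j)
  ∑<-blocks zero    m f = refl
  ∑<-blocks (suc n) m f = trans (∑<-++ m (n ℕ.* m) f)
    (cong (λ z → ∑< m f + z) (trans (∑<-blocks n m (λ k → f (m ℕ.+ k)))
      (∑<-cong n λ k → ∑<-cong m λ j → cong f (sym (ℕ.+-assoc m (k ℕ.* m) j)))))

  ∑<-dist : ∀ n (f g : ℕ → ℚ) e → (∀ k → k ℕ.< n → ∣ f k - g k ∣ ≤ e) →
            ∣ ∑< n f - ∑< n g ∣ ≤ ι n * e
  ∑<-dist zero    f g e _ = ≤-reflexive (sym (trans (cong (_* e) ι0≡0) (*-zeroˡ e)))
  ∑<-dist (suc n) f g e h = begin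
    ∣ (f 0 + F) - (g 0 + G) ∣    ≡⟨ cong ∣_∣ (solve 4 (λ a b c d →
                                      (a :+ b) :- (c :+ d) := (a :- c) :+ (b :- d))
                                      refl (f 0) F (g 0) G) ⟩
    ∣ (f 0 - g 0) + (F - G) ∣    ≤⟨ ∣p+q∣≤∣p∣+∣q∣ (f 0 - g 0) (F - G) ⟩
    ∣ f 0 - g 0 ∣ + ∣ F - G ∣    ≤⟨ +-mono-≤ (h 0 (ℕ.s≤s ℕ.z≤n))
                                     (∑<-dist n (f ∘ suc) (g ∘ suc) e (λ k k<n → h (suc k) (ℕ.s≤s k<n))) ⟩
    e + ι n * e                  ≡⟨ solve 2 (λ c i → c :+ i :* c := (con 1ℚ :+ i) :* c) refl e (ι n) ⟩
    (1ℚ + ι n) * e               ≡⟨ cong (_* e) (ι-suc n) ⟨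
    ι (suc n) * e                ∎
    where
    open ≤-Reasoning
    F = ∑< n (f ∘ suc)
    G = ∑< n (g ∘ suc)

open ∑<-Lemmas

-- The Riemann sums of a function that is Lipschitz on the segment between a and b
-- form a Cauchy sequence.
module _ (f : ℚ → ℚ) (a b K : ℚ) where

  LipschitzBetween : Set
  LipschitzBetween = ∀ s t → 0ℚ ≤ s → s ≤ 1ℚ → 0ℚ ≤ t → t ≤ 1ℚ →
    ∣ f (a + s * (b - a)) - f (a + t * (b - a)) ∣ ≤ K * ∣ s - t ∣

  module _ (0≤K : 0ℚ ≤ K) (lip : LipschitzBetween) where
    private
      w = b - a
      R : ℕ → ℚ
      R n = ∑< (suc n) λ k → f (a + (+ k / suc n) * w) * (w * r n)
      R≡ : ∀ n → riemann f a b (suc n) ≡ R n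
      R≡ n = cong (λ z → ∑< (suc n) λ k → f (a + (+ k / suc n) * w) * (w * z)) (r≡ n)
      g : ℚ → ℚ
      g s = f (a + s * w)
      E = K * ∣ w ∣

      ι*r≤1 : ∀ k n → k ℕ.≤ suc n → ι k * r n ≤ 1ℚ
      ι*r≤1 k n k≤n = ≤-trans
        (*-monoʳ-≤-nonNeg (r n) {{nonNegative (0≤r n)}} (ι-mono k≤n))
        (≤-reflexive (ι*r n))

      -- the number of steps of the common refinement, minus one
      _⊛_ : ℕ → ℕ → ℕ
      n ⊛ m = m ℕ.+ n ℕ.* suc m

      r-⊛ : ∀ n m → ι (suc m) * r (n ⊛ m) ≡ r n
      r-⊛ n m = begin
        ι M * p                      ≡⟨ *-identityˡ (ι M * p) ⟨
        1ℚ * (ι M * p)               ≡⟨ cong (_* (ι M * p)) (ι*r n) ⟨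
        ι N * r n * (ι M * p)        ≡⟨ solve 4 (λ x y z u → x :* y :* (z :* u) := y :* (x :* z :* u))
                                          refl (ι N) (r n) (ι M) p ⟩
        r n * (ι N * ι M * p)        ≡⟨ cong (λ z → r n * (z * p)) (ι-* N M) ⟨
        r n * (ι (N ℕ.* M) * p)      ≡⟨ cong (r n *_) (ι*r (n ⊛ m)) ⟩
        r n * 1ℚ                     ≡⟨ *-identityʳ (r n) ⟩
        r n                          ∎
        where
        open ≡-Reasoning
        N = suc n
        M = suc m
        p = r (n ⊛ m)

      term : ∀ n m k j → k ℕ.< suc n → j ℕ.< suc m →
        ∣ g (+ k / suc n) * (w * r (n ⊛ m))
          - g (+ (k ℕ.* suc m ℕ.+ j) / suc (n ⊛ m)) * (w * r (n ⊛ m)) ∣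
        ≤ E * r n * r (n ⊛ m)
      term n m k j k<N j<M = begin
        ∣ g s * (w * p) - g t * (w * p) ∣
          ≡⟨ cong ∣_∣ (solve 3 (λ x y z → x :* z :- y :* z := (x :- y) :* z) refl (g s) (g t) (w * p)) ⟩
        ∣ (g s - g t) * (w * p) ∣
          ≡⟨ trans (∣p*q∣≡∣p∣*∣q∣ (g s - g t) (w * p))
               (cong (∣ g s - g t ∣ *_) (trans (∣p*q∣≡∣p∣*∣q∣ w p)
                 (cong (∣ w ∣ *_) (0≤p⇒∣p∣≡p (0≤r (n ⊛ m)))))) ⟩
        ∣ g s - g t ∣ * (∣ w ∣ * p)
          ≤⟨ *-monoʳ-≤-nonNeg (∣ w ∣ * p) {{nonNegative (0≤* 0≤∣ w ∣ (0≤r (n ⊛ m)))}}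
               (≤-trans (lip s t 0≤s s≤1 0≤t t≤1)
                 (*-monoˡ-≤-nonNeg K {{nonNegative 0≤K}} ∣s-t∣≤)) ⟩
        K * r n * (∣ w ∣ * p)
          ≡⟨ solve 4 (λ x y z u → x :* y :* (z :* u) := x :* z :* y :* u) refl K (r n) ∣ w ∣ p ⟩
        E * r n * p ∎
        where
        open ≤-Reasoning
        N = suc n
        M = suc m
        p = r (n ⊛ m)
        l = k ℕ.* M ℕ.+ j
        s = + k / N
        t = + l / suc (n ⊛ m)
        s≡ : s ≡ ι k * r n
        s≡ = /≡ι*r k n
        t≡ : t ≡ ι l * p
        t≡ = /≡ι*r l (n ⊛ m)
        l≤ : l ℕ.≤ suc (n ⊛ m)
        l≤ = ℕ.≤-trans (ℕ.+-monoʳ-≤ (k ℕ.* M) (ℕ.<⇒≤ j<M))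
          (ℕ.≤-trans (ℕ.≤-reflexive (ℕ.+-comm (k ℕ.* M) M)) (ℕ.*-monoˡ-≤ M k<N))
        0≤s = subst (0ℚ ≤_) (sym s≡) (0≤* (0≤ι k) (0≤r n))
        0≤t = subst (0ℚ ≤_) (sym t≡) (0≤* (0≤ι l) (0≤r (n ⊛ m)))
        s≤1 = subst (_≤ 1ℚ) (sym s≡) (ι*r≤1 k n (ℕ.<⇒≤ k<N))
        t≤1 = subst (_≤ 1ℚ) (sym t≡) (ι*r≤1 l (n ⊛ m) l≤)
        t-s : t - s ≡ ι j * p
        t-s = trans (cong₂ _-_ t≡ s≡) (trans
          (cong₂ (λ u v → u * p - ι k * v)
            (trans (ι-+ (k ℕ.* M) j) (cong (_+ ι j) (ι-* k M))) (sym (r-⊛ n m)))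
          (solve 4 (λ k M j p → (k :* M :+ j) :* p :- k :* (M :* p) := j :* p)
            refl (ι k) (ι M) (ι j) p))
        ∣s-t∣≤ : ∣ s - t ∣ ≤ r n
        ∣s-t∣≤ = begin
          ∣ s - t ∣     ≡⟨ ∣p-q∣≡∣q-p∣ s t ⟩
          ∣ t - s ∣     ≡⟨ cong ∣_∣ t-s ⟩
          ∣ ι j * p ∣   ≡⟨ 0≤p⇒∣p∣≡p (0≤* (0≤ι j) (0≤r (n ⊛ m))) ⟩
          ι j * p       ≤⟨ *-monoʳ-≤-nonNeg p {{nonNegative (0≤r (n ⊛ m))}} (ι-mono (ℕ.<⇒≤ j<M)) ⟩
          ι M * p       ≡⟨ r-⊛ n m ⟩
          r n           ∎

      refine : ∀ n m → ∣ R n - R (n ⊛ m) ∣ ≤ E * r n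
      refine n m = begin
        ∣ R n - R (n ⊛ m) ∣
          ≡⟨ cong₂ (λ u v → ∣ u - v ∣) split (∑<-blocks N M H) ⟩
        ∣ (∑< N λ k → ∑< M λ _ → G k) - (∑< N λ k → ∑< M λ j → H (k ℕ.* M ℕ.+ j)) ∣
          ≤⟨ ∑<-dist N (λ k → ∑< M λ _ → G k) (λ k → ∑< M λ j → H (k ℕ.* M ℕ.+ j))
               (ι M * (E * r n * p)) (λ k k<N →
               ∑<-dist M (λ _ → G k) (λ j → H (k ℕ.* M ℕ.+ j)) (E * r n * p) (λ j j<M → term n m k j k<N j<M)) ⟩
        ι N * (ι M * (E * r n * p))
          ≡⟨ solve 4 (λ x y z u → x :* (y :* (z :* u)) := z :* (x :* (y :* u)))
               refl (ι N) (ι M) (E * r n) p ⟩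
        E * r n * (ι N * (ι M * p))
          ≡⟨ cong (λ z → E * r n * (ι N * z)) (r-⊛ n m) ⟩
        E * r n * (ι N * r n)
          ≡⟨ cong (E * r n *_) (ι*r n) ⟩
        E * r n * 1ℚ
          ≡⟨ *-identityʳ (E * r n) ⟩
        E * r n ∎
        where
        open ≤-Reasoning
        N = suc n
        M = suc m
        p = r (n ⊛ m)
        G H : ℕ → ℚ
        G k = g (+ k / N) * (w * p)
        H l = g (+ l / suc (n ⊛ m)) * (w * p)
        split : R n ≡ ∑< N λ k → ∑< M λ _ → G k
        split = ∑<-cong N λ k → sym (trans (∑<-const M (G k)) (trans
          (solve 4 (λ x y z u → x :* (y :* (z :* u)) := y :* (z :* (x :* u)))
            refl (ι M) (g (+ k / N)) w p)
          (cong (λ z → g (+ k / N) * (w * z)) (r-⊛ n m))))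

      ⊛-comm : ∀ n m → n ⊛ m ≡ m ⊛ n
      ⊛-comm n m = ℕ.suc-injective (ℕ.*-comm (suc n) (suc m))

    riemann-cauchy : IsCauchy (λ n → riemann f a b (suc n))
    riemann-cauchy ε 0<ε =
      let N , small = K*r-small E (ε * ½) (0<½* 0<ε)
      in N , λ m n m≥ n≥ → bound m n (small m m≥) (small n n≥)
      where
      open ≤-Reasoning
      bound : ∀ m n → E * r m ≤ ε * ½ → E * r n ≤ ε * ½ →
              ∣ riemann f a b (suc m) - riemann f a b (suc n) ∣ ≤ ε
      bound m n m-small n-small = begin
        ∣ riemann f a b (suc m) - riemann f a b (suc n) ∣
          ≡⟨ cong₂ (λ u v → ∣ u - v ∣) (R≡ m) (R≡ n) ⟩
        ∣ R m - R n ∣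
          ≤⟨ triangle (R m) (R (m ⊛ n)) (R n) ⟩
        ∣ R m - R (m ⊛ n) ∣ + ∣ R (m ⊛ n) - R n ∣
          ≡⟨ cong (λ z → ∣ R m - R (m ⊛ n) ∣ + z)
               (trans (∣p-q∣≡∣q-p∣ (R (m ⊛ n)) (R n)) (cong (λ z → ∣ R n - R z ∣) (⊛-comm m n))) ⟩
        ∣ R m - R (m ⊛ n) ∣ + ∣ R n - R (n ⊛ m) ∣
          ≤⟨ +-mono-≤ (≤-trans (refine m n) m-small) (≤-trans (refine n m) n-small) ⟩
        ε * ½ + ε * ½
          ≡⟨ halves ε ⟩
        ε ∎

module ⁻¹-Lemmas where

  ⁻¹-inverseˡ : ∀ {p} → 0ℚ < p → p ⁻¹ * p ≡ 1ℚ
  ⁻¹-inverseˡ {p} 0<p with p ≟ 0ℚ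
  ... | yes p≡0 = contradiction (sym p≡0) (<⇒≢ 0<p)
  ... | no  p≢0 = *-inverseˡ p {{≢-nonZero p≢0}}

  0≤⁻¹ : ∀ {p} → 0ℚ < p → 0ℚ ≤ p ⁻¹
  0≤⁻¹ {p} 0<p = *-cancelʳ-≤-pos p {{positive 0<p}} (begin
    0ℚ * p      ≡⟨ *-zeroˡ p ⟩
    0ℚ          ≤⟨ <⇒≤ (positive⁻¹ 1ℚ) ⟩
    1ℚ          ≡⟨ ⁻¹-inverseˡ 0<p ⟨
    p ⁻¹ * p    ∎)
    where open ≤-Reasoning

  ⁻¹-anti : ∀ {p q} → 0ℚ < p → p ≤ q → q ⁻¹ ≤ p ⁻¹
  ⁻¹-anti {p} {q} 0<p p≤q = begin
    q ⁻¹                  ≡⟨ *-identityʳ (q ⁻¹) ⟨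
    q ⁻¹ * 1ℚ             ≡⟨ cong (q ⁻¹ *_) (⁻¹-inverseˡ 0<p) ⟨
    q ⁻¹ * (p ⁻¹ * p)     ≤⟨ *-monoˡ-≤-nonNeg (q ⁻¹) {{nonNegative (0≤⁻¹ 0<q)}}
                               (*-monoˡ-≤-nonNeg (p ⁻¹) {{nonNegative (0≤⁻¹ 0<p)}} p≤q) ⟩
    q ⁻¹ * (p ⁻¹ * q)     ≡⟨ solve 3 (λ x y z → x :* (y :* z) := y :* (x :* z)) refl (q ⁻¹) (p ⁻¹) q ⟩
    p ⁻¹ * (q ⁻¹ * q)     ≡⟨ cong (p ⁻¹ *_) (⁻¹-inverseˡ 0<q) ⟩
    p ⁻¹ * 1ℚ             ≡⟨ *-identityʳ (p ⁻¹) ⟩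
    p ⁻¹                  ∎
    where
    open ≤-Reasoning
    0<q = <-≤-trans 0<p p≤q

  module _ (y : ℚ) (0<y : 0ℚ < y) where
    c C w : ℚ
    c = 1ℚ ⊓ y
    C = c ⁻¹
    w = y - 1ℚ

    0<c : 0ℚ < c
    0<c with ⊓-sel 1ℚ y
    ... | inj₁ eq = subst (0ℚ <_) (sym eq) (positive⁻¹ 1ℚ)
    ... | inj₂ eq = subst (0ℚ <_) (sym eq) 0<y

    c≤ : ∀ s → 0ℚ ≤ s → s ≤ 1ℚ → c ≤ 1ℚ + s * w
    c≤ s 0≤s s≤1 = begin
      c                         ≡⟨ solve 2 (λ c s → c := (con 1ℚ :- s) :* c :+ s :* c) refl c s ⟩
      (1ℚ - s) * c + s * c      ≤⟨ +-mono-≤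
                                     (*-monoˡ-≤-nonNeg (1ℚ - s) {{nonNegative 0≤1-s}} (p⊓q≤p 1ℚ y))
                                     (*-monoˡ-≤-nonNeg s {{nonNegative 0≤s}} (p⊓q≤q 1ℚ y)) ⟩
      (1ℚ - s) * 1ℚ + s * y     ≡⟨ solve 2 (λ y s → (con 1ℚ :- s) :* con 1ℚ :+ s :* y
                                     := con 1ℚ :+ s :* (y :- con 1ℚ)) refl y s ⟩
      1ℚ + s * w                ∎
      where
      open ≤-Reasoning
      0≤1-s : 0ℚ ≤ 1ℚ - s
      0≤1-s = subst (_≤ 1ℚ - s) (+-inverseʳ s) (+-monoˡ-≤ (- s) s≤1)

    ⁻¹-lipschitz : LipschitzBetween _⁻¹ 1ℚ y (∣ w ∣ * (C * C))
    ⁻¹-lipschitz s t 0≤s s≤1 0≤t t≤1 = begin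
      ∣ p ⁻¹ - q ⁻¹ ∣
        ≡⟨ cong ∣_∣ eq ⟩
      ∣ w * (t - s) * (p ⁻¹ * q ⁻¹) ∣
        ≡⟨ trans (∣p*q∣≡∣p∣*∣q∣ (w * (t - s)) _)
             (cong₂ _*_ (trans (∣p*q∣≡∣p∣*∣q∣ w (t - s)) (cong (∣ w ∣ *_) (∣p-q∣≡∣q-p∣ t s)))
                        (0≤p⇒∣p∣≡p (0≤* (0≤⁻¹ 0<p) (0≤⁻¹ 0<q)))) ⟩
      ∣ w ∣ * ∣ s - t ∣ * (p ⁻¹ * q ⁻¹)
        ≤⟨ *-monoˡ-≤-nonNeg (∣ w ∣ * ∣ s - t ∣) {{nonNegative (0≤* 0≤∣ w ∣ 0≤∣ s - t ∣)}}
             (*-mono-≤-nonNeg (0≤⁻¹ 0<p) (0≤⁻¹ 0<q) (⁻¹-anti 0<c c≤p) (⁻¹-anti 0<c c≤q)) ⟩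
      ∣ w ∣ * ∣ s - t ∣ * (C * C)
        ≡⟨ solve 3 (λ x y z → x :* y :* z := x :* z :* y) refl ∣ w ∣ ∣ s - t ∣ (C * C) ⟩
      ∣ w ∣ * (C * C) * ∣ s - t ∣ ∎
      where
      open ≤-Reasoning
      p = 1ℚ + s * w
      q = 1ℚ + t * w
      c≤p = c≤ s 0≤s s≤1
      c≤q = c≤ t 0≤t t≤1
      0<p = <-≤-trans 0<c c≤p
      0<q = <-≤-trans 0<c c≤q
      eq : p ⁻¹ - q ⁻¹ ≡ w * (t - s) * (p ⁻¹ * q ⁻¹)
      eq = begin-equality
        p ⁻¹ - q ⁻¹
          ≡⟨ cong₂ _-_ (*-identityʳ (p ⁻¹)) (*-identityʳ (q ⁻¹)) ⟨
        p ⁻¹ * 1ℚ - q ⁻¹ * 1ℚ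
          ≡⟨ cong₂ (λ u v → p ⁻¹ * u - q ⁻¹ * v) (⁻¹-inverseˡ 0<q) (⁻¹-inverseˡ 0<p) ⟨
        p ⁻¹ * (q ⁻¹ * q) - q ⁻¹ * (p ⁻¹ * p)
          ≡⟨ solve 5 (λ x y s t w →
               x :* (y :* (con 1ℚ :+ t :* w)) :- y :* (x :* (con 1ℚ :+ s :* w))
               := w :* (t :- s) :* (x :* y)) refl (p ⁻¹) (q ⁻¹) s t w ⟩
        w * (t - s) * (p ⁻¹ * q ⁻¹) ∎

open ⁻¹-Lemmas

-- ln y = ∫₁ʸ dt / t for y > 0, as the limit of Riemann sums. The value 0 for y ≤ 0 is junk;
-- in α² ln (α ⁻¹) with α = 0 it is multiplied by 0, which gives the conventional value 0.
ln : ℚ → ℝ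
ln y with 0ℚ <? y
... | yes 0<y = mkℝ (λ n → riemann _⁻¹ 1ℚ y (suc n))
                    (riemann-cauchy _⁻¹ 1ℚ y (∣ w y 0<y ∣ * (C y 0<y * C y 0<y))
                      (0≤* 0≤∣ w y 0<y ∣ (0≤* (0≤⁻¹ (0<c y 0<y)) (0≤⁻¹ (0<c y 0<y))))
                      (⁻¹-lipschitz y 0<y))
... | no  _   = 0ℝ

Cube : ℕ → Set
Cube n = Vec Sign n

cube : ∀ n → List (Cube n)
cube zero    = [] ∷ []
cube (suc n) = cartesianProductWith _∷_ (Sign.- ∷ Sign.+ ∷ []) (cube n)

±1 : Sign → ℝ
±1 Sign.- = fromℚ (- 1ℚ)
±1 Sign.+ = 1ℝ

𝔼 : ∀ {n} → (Cube n → ℝ) → ℝ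
𝔼 {n} f = fromℚ ((+ 1 / 2 ℕ.^ n) {{ℕ.m^n≢0 2 n}}) *ℝ ∑ (cube n) f

χ : ∀ {n} → Subset n → Cube n → ℝ
χ {n} S x = ∏ (filter (_∈? S) (allFin n)) λ i → ±1 (lookup x i)

fourier : ∀ {n} → (Cube n → ℝ) → Subset n → ℝ
fourier f S = 𝔼 λ x → f x *ℝ χ S x

module _ {n} {A : Pred (Cube n) 0ℓ} (A? : Decidable A) where

  density : ℚ
  density = (+ length (filter A? (cube n)) / 2 ℕ.^ n) {{ℕ.m^n≢0 2 n}}

  indicator : Cube n → ℝ
  indicator x = if does (A? x) then 1ℝ else 0ℝ

{-# OPTIONS --safe #-}
-- The proof is a Gibbs inequality, made rational by replacing logarithms with sums of z − 1 over
-- factors z. Let ε i be the mean of the i-th coordinate over A, so that f̂({i}) = α (ε i). For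
-- x ∈ A write 1 as the product of
--   · α⁻¹, split into ratios of consecutive nodes of the Riemann partition of [1, α⁻¹];
--   · α W(x), where W(x) = ∏ᵢ (1 + tᵢ xᵢ) is a density on the cube, with tᵢ slightly short of ε i;
--   · the inverses of the factors 1 + tᵢ xᵢ, split along an equal partition of [0, tᵢ].
-- By AM-GM the sum of all z − 1 is nonnegative. The first group contributes exactly the Riemann
-- sum R of ln (α⁻¹); averaged over A, the second contributes at most 0, because the mean of W over
-- the cube is 1, and the third at most − ½ Σᵢ (ε i)², up to a factor tending to 1.
module Submission where

open import Defs
open import Data.Fin.Base using (Fin; zero; suc)
import Data.Fin.Properties as Fin
open import Data.Fin.Subset using (⁅_⁆)
open import Data.Fin.Subset.Properties using (_∈?_; x∈⁅x⁆; x∈⁅y⁆⇒x≡y)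
import Data.Integer.Base as ℤ
open import Data.List.Base
  using (List; []; _∷_; _++_; allFin; filter; foldr; length; map; tabulate)
import Data.List.Properties as List
import Data.List.Relation.Unary.All.Properties as All
open import Data.Nat.Base as ℕ using (ℕ; _≤_; zero; suc)
import Data.Nat.Properties as ℕ
open import Data.Product.Base using (_×_; _,_; ∃; proj₁; proj₂)
open import Data.Rational.Base as ℚ using (ℚ; 0ℚ; 1ℚ; _+_; _*_; _-_; -_; _/_; nonNegative; positive)
open import Data.Rational.Properties as ℚ using (positive⁻¹)
open import Data.Rational.Solver using (module +-*-Solver)
open import Data.Sign.Base as Sign using (Sign)
open import Data.Sum.Base using (inj₁; inj₂)
open import Data.Vec.Base using (lookup; _∷_)
open import Function.Base using (_∘_; id)
open import Level using (0ℓ)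
open import Relation.Binary.PropositionalEquality
open import Relation.Nullary.Decidable.Core using (yes; no)
open import Relation.Nullary.Negation.Core using (contradiction)
open import Relation.Unary using (Pred; Decidable)

open +-*-Solver using (solve; _:=_; _:+_; _:*_; _:-_; :-_; con)
open ℚ-Lemmas
open ∑<-Lemmas
open ⁻¹-Lemmas using (⁻¹-inverseˡ; 0≤⁻¹; ⁻¹-anti)

private
  variable
    X : Set

-- Order and powers of rationals.

p≤q⇒0≤q-p : ∀ {p q} → p ℚ.≤ q → 0ℚ ℚ.≤ q - p
p≤q⇒0≤q-p {p} {q} p≤q = subst (ℚ._≤ q - p) (ℚ.+-inverseʳ p) (ℚ.+-monoˡ-≤ (- p) p≤q)

0≤q-p⇒p≤q : ∀ {p q} → 0ℚ ℚ.≤ q - p → p ℚ.≤ q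
0≤q-p⇒p≤q {p} {q} 0≤q-p = subst₂ ℚ._≤_ (ℚ.+-identityʳ p)
  (solve 2 (λ p q → p :+ (q :- p) := q) refl p q) (ℚ.+-monoʳ-≤ p 0≤q-p)

0≤p*p : ∀ p → 0ℚ ℚ.≤ p * p
0≤p*p p with ℚ.≤-total 0ℚ p
... | inj₁ 0≤p = 0≤* 0≤p 0≤p
... | inj₂ p≤0 = subst (0ℚ ℚ.≤_)
  (solve 1 (λ p → (:- p) :* (:- p) := p :* p) refl p) (0≤* 0≤-p 0≤-p)
  where 0≤-p = ℚ.neg-antimono-≤ p≤0

0≤1ℚ : 0ℚ ℚ.≤ 1ℚ
0≤1ℚ = ℚ.<⇒≤ (positive⁻¹ 1ℚ)

infixr 8 _^_

_^_ : ℚ → ℕ → ℚ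
p ^ zero  = 1ℚ
p ^ suc n = p * p ^ n

0≤^ : ∀ {p} n → 0ℚ ℚ.≤ p → 0ℚ ℚ.≤ p ^ n
0≤^ zero    0≤p = 0≤1ℚ
0≤^ (suc n) 0≤p = 0≤* 0≤p (0≤^ n 0≤p)

^≤1 : ∀ {p} n → 0ℚ ℚ.≤ p → p ℚ.≤ 1ℚ → p ^ n ℚ.≤ 1ℚ
^≤1         zero    0≤p p≤1 = ℚ.≤-refl
^≤1 {p} (suc n) 0≤p p≤1 = ℚ.≤-trans
  (*-mono-≤-nonNeg 0≤p (0≤^ n 0≤p) p≤1 (^≤1 n 0≤p p≤1)) (ℚ.≤-reflexive (ℚ.*-identityˡ 1ℚ))

-- The right-hand side is convex in p; the left-hand side is its tangent at q.
^-tangent : ∀ {p q} n → 0ℚ ℚ.≤ p → 0ℚ ℚ.≤ q → q ^ n * (ι (suc n) * p - ι n * q) ℚ.≤ p ^ suc n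
^-tangent {p} {q} zero 0≤p 0≤q = ℚ.≤-reflexive (begin
  1ℚ * (ι 1 * p - ι 0 * q)     ≡⟨ cong₂ (λ a b → 1ℚ * (a * p - b * q))
                                    (trans (ι-suc 0) (cong (1ℚ +_) ι0≡0)) ι0≡0 ⟩
  1ℚ * ((1ℚ + 0ℚ) * p - 0ℚ * q)  ≡⟨ solve 2 (λ p q → con 1ℚ :* ((con 1ℚ :+ con 0ℚ) :* p :- con 0ℚ :* q)
                                    := p :* con 1ℚ) refl p q ⟩
  p * 1ℚ                       ∎)
  where open ≡-Reasoning
^-tangent {p} {q} (suc n) 0≤p 0≤q = begin
  q * Q * (ι (suc (suc n)) * p - ι (suc n) * q)
    ≡⟨ cong₂ (λ a b → q * Q * (a * p - b * q)) (trans (ι-suc (suc n)) (cong (1ℚ +_) (ι-suc n))) (ι-suc n) ⟩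
  q * Q * ((1ℚ + (1ℚ + m)) * p - (1ℚ + m) * q)
    -- The two sides differ by `q ^ n` times (n + 1) (p - q)².
    ≤⟨ 0≤q-p⇒p≤q (subst (0ℚ ℚ.≤_)
         (solve 4 (λ p q Q m → Q :* (con 1ℚ :+ m) :* ((p :- q) :* (p :- q))
           := p :* (Q :* ((con 1ℚ :+ m) :* p :- m :* q))
              :- q :* Q :* ((con 1ℚ :+ (con 1ℚ :+ m)) :* p :- (con 1ℚ :+ m) :* q)) refl p q Q m)
         (0≤* (0≤* (0≤^ n 0≤q) (subst (0ℚ ℚ.≤_) (ι-suc n) (0≤ι (suc n)))) (0≤p*p (p - q)))) ⟩
  p * (Q * ((1ℚ + m) * p - m * q))
    ≡⟨ cong (λ a → p * (Q * (a * p - m * q))) (ι-suc n) ⟨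
  p * (Q * (ι (suc n) * p - m * q))
    ≤⟨ ℚ.*-monoˡ-≤-nonNeg p {{nonNegative 0≤p}} (^-tangent n 0≤p 0≤q) ⟩
  p * p ^ suc n ∎
  where
  open ℚ.≤-Reasoning
  m = ι n
  Q = q ^ n

-- Exponential bounds from AM-GM.

infix 4 _≤exp_

-- A certificate for x ≤ exp v, from z ≤ exp (z − 1).
data _≤exp_ : ℚ → ℚ → Set where
  one   : 1ℚ ≤exp 0ℚ
  scale : ∀ {x v} z → 0ℚ ℚ.≤ z → x ≤exp v → z * x ≤exp v + (z - 1ℚ)

-- Here `m` counts the factors z of the certificate and `A` is their arithmetic mean, because their
-- sum is `ι m + v`. The bound on `x` is then AM-GM.
am-gm : ∀ {x v} → x ≤exp v → ∃ λ m → ∃ λ A → 0ℚ ℚ.≤ A × x ℚ.≤ A ^ m × ι m * A ≡ ι m + v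
am-gm one = 0 , 0ℚ , ℚ.≤-refl , ℚ.≤-refl ,
  trans (ℚ.*-zeroʳ (ι 0)) (sym (trans (ℚ.+-identityʳ (ι 0)) ι0≡0))
am-gm (scale {x} {v} z 0≤z x≤v) with am-gm x≤v
... | m , A , 0≤A , x≤A^m , mA = suc m , B , 0≤B , zx≤B , trans mB (begin
    z + ι m * A                ≡⟨ cong (z +_) mA ⟩
    z + (ι m + v)              ≡⟨ solve 3 (λ z m v → z :+ (m :+ v) := con 1ℚ :+ m :+ (v :+ (z :- con 1ℚ)))
                                    refl z (ι m) v ⟩
    1ℚ + ι m + (v + (z - 1ℚ))  ≡⟨ cong (_+ (v + (z - 1ℚ))) (ι-suc m) ⟨
    ι (suc m) + (v + (z - 1ℚ)) ∎)
  where
  open ≡-Reasoning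
  B = (z + ι m * A) * r m
  0≤B : 0ℚ ℚ.≤ B
  0≤B = 0≤* (ℚ.+-mono-≤ 0≤z (0≤* (0≤ι m) 0≤A)) (0≤r m)
  mB : ι (suc m) * B ≡ z + ι m * A
  mB = trans (solve 3 (λ i c r → i :* (c :* r) := i :* r :* c) refl (ι (suc m)) (z + ι m * A) (r m))
    (trans (cong (_* (z + ι m * A)) (ι*r m)) (ℚ.*-identityˡ (z + ι m * A)))
  -- The tangent at the old mean `A`, evaluated at the new mean `B`, is `A ^ m * z`, because
  -- `ι (suc m) * B - ι m * A` equals `z`.
  zx≤B : z * x ℚ.≤ B ^ suc m
  zx≤B = ℚ.≤-trans (ℚ.*-monoˡ-≤-nonNeg z {{nonNegative 0≤z}} x≤A^m)
    (subst (ℚ._≤ B ^ suc m)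
      (trans (cong (λ b → A ^ m * (b - ι m * A)) mB)
        (solve 3 (λ p z a → p :* (z :+ a :- a) := z :* p) refl (A ^ m) z (ι m * A)))
      (^-tangent m 0≤B 0≤A))

-- If the mean `A` of the factors were below 1, so would be its positive powers. Hence `A` is at
-- least 1, and `v`, the sum of all z - 1, is nonnegative. Without factors, `v` is 0.
1≤exp⇒0≤ : ∀ {v} → 1ℚ ≤exp v → 0ℚ ℚ.≤ v
1≤exp⇒0≤ {v} 1≤v with am-gm 1≤v
... | zero , A , 0≤A , _ , 0A≡ = ℚ.≤-reflexive (begin
  0ℚ        ≡⟨ ℚ.*-zeroˡ A ⟨
  0ℚ * A    ≡⟨ cong (_* A) ι0≡0 ⟨
  ι 0 * A   ≡⟨ 0A≡ ⟩
  ι 0 + v   ≡⟨ cong (_+ v) ι0≡0 ⟩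
  0ℚ + v    ≡⟨ ℚ.+-identityˡ v ⟩
  v         ∎)
  where open ≡-Reasoning
... | suc m , A , 0≤A , 1≤A^ , mA≡ with 1ℚ ℚ.≤? A
...   | yes 1≤A = subst (0ℚ ℚ.≤_)
  (trans (cong (_- ι (suc m)) mA≡) (solve 2 (λ m v → m :+ v :- m := v) refl (ι (suc m)) v))
  (p≤q⇒0≤q-p (subst (ℚ._≤ ι (suc m) * A) (ℚ.*-identityʳ (ι (suc m)))
    (ℚ.*-monoˡ-≤-nonNeg (ι (suc m)) {{nonNegative (0≤ι (suc m))}} 1≤A)))
...   | no 1≰A = contradiction (ℚ.≤-trans 1≤A^ A^≤A) 1≰A
  where
  A^≤A : A * A ^ m ℚ.≤ A
  A^≤A = subst (A * A ^ m ℚ.≤_) (ℚ.*-identityʳ A)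
    (ℚ.*-monoˡ-≤-nonNeg A {{nonNegative 0≤A}} (^≤1 m 0≤A (ℚ.<⇒≤ (ℚ.≰⇒> 1≰A))))

-- Riemann sums of the logarithm.

-- Step k scales by `1ℚ + f k`, which adds exactly `f k` to the exponent.
chain : ∀ m (f z : ℕ → ℚ) {v} → (∀ k → 0ℚ ℚ.≤ f k) → (∀ k → (1ℚ + f k) * z k ≡ z (suc k)) →
        z 0 ≤exp v → z m ≤exp v + ∑< m f
chain zero    f z {v} 0≤f step z0 = subst (z 0 ≤exp_) (sym (ℚ.+-identityʳ v)) z0
chain (suc m) f z {v} 0≤f step z0 = subst (z (suc m) ≤exp_)
  (solve 3 (λ v a s → v :+ (con 1ℚ :+ a :- con 1ℚ) :+ s := v :+ (a :+ s)) refl v (f 0) _)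
  (chain m (f ∘ suc) (z ∘ suc) (0≤f ∘ suc) (step ∘ suc)
    (subst (_≤exp v + (1ℚ + f 0 - 1ℚ)) (step 0)
      (scale (1ℚ + f 0) (ℚ.+-mono-≤ 0≤1ℚ (0≤f 0)) z0)))

-- The ratio of the nodes `z (suc k)` and `z k` exceeds 1 by `h` over `z k`, the k-th term of the
-- left Riemann sum, and the product of the ratios telescopes from 1 to `y`.
≤exp-riemann : ∀ y n → 1ℚ ℚ.≤ y → y ≤exp riemann _⁻¹ 1ℚ y (suc n)
≤exp-riemann y n 1≤y = subst₂ _≤exp_ last eq
  (chain (suc n) f z 0≤f step (subst (_≤exp 0ℚ) (sym z0≡1) one))
  where
  w = y - 1ℚ
  0≤w = p≤q⇒0≤q-p 1≤y
  h = w * r n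
  z f : ℕ → ℚ
  z k = 1ℚ + ι k * r n * w
  f k = z k ⁻¹ * h
  z0≡1 : z 0 ≡ 1ℚ
  z0≡1 = trans (cong (λ i → 1ℚ + i * r n * w) ι0≡0)
    (solve 2 (λ r w → con 1ℚ :+ con 0ℚ :* r :* w := con 1ℚ) refl (r n) w)
  0<z : ∀ k → 0ℚ ℚ.< z k
  0<z k = ℚ.<-≤-trans (positive⁻¹ 1ℚ) (subst (ℚ._≤ z k) (ℚ.+-identityʳ 1ℚ)
    (ℚ.+-monoʳ-≤ 1ℚ (0≤* (0≤* (0≤ι k) (0≤r n)) 0≤w)))
  0≤f : ∀ k → 0ℚ ℚ.≤ f k
  0≤f k = 0≤* (0≤⁻¹ (0<z k)) (0≤* 0≤w (0≤r n))
  step : ∀ k → (1ℚ + f k) * z k ≡ z (suc k)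
  step k = begin
    (1ℚ + z k ⁻¹ * h) * z k   ≡⟨ solve 3 (λ i h z → (con 1ℚ :+ i :* h) :* z := z :+ i :* z :* h)
                                   refl (z k ⁻¹) h (z k) ⟩
    z k + z k ⁻¹ * z k * h    ≡⟨ cong (λ a → z k + a * h) (⁻¹-inverseˡ (0<z k)) ⟩
    z k + 1ℚ * h              ≡⟨ solve 3 (λ i r w → con 1ℚ :+ i :* r :* w :+ con 1ℚ :* (w :* r)
                                   := con 1ℚ :+ (con 1ℚ :+ i) :* r :* w) refl (ι k) (r n) w ⟩
    1ℚ + (1ℚ + ι k) * r n * w ≡⟨ cong (λ i → 1ℚ + i * r n * w) (ι-suc k) ⟨
    z (suc k)                 ∎
    where open ≡-Reasoning
  last : z (suc n) ≡ y
  last = trans (cong (λ a → 1ℚ + a * w) (ι*r n))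
    (solve 1 (λ y → con 1ℚ :+ con 1ℚ :* (y :- con 1ℚ) := y) refl y)
  eq : 0ℚ + ∑< (suc n) f ≡ riemann _⁻¹ 1ℚ y (suc n)
  eq = trans (ℚ.+-identityˡ _) (∑<-cong (suc n) λ k →
    sym (cong₂ (λ a b → (1ℚ + a * w) ⁻¹ * (w * b)) (/≡ι*r k n) (r≡ n)))

-- Finite sums and products of rationals.

sum : List X → (X → ℚ) → ℚ
sum xs f = foldr _+_ 0ℚ (map f xs)

prod : List X → (X → ℚ) → ℚ
prod xs f = foldr _*_ 1ℚ (map f xs)

sum-cong : ∀ (xs : List X) {f g : X → ℚ} → (∀ x → f x ≡ g x) → sum xs f ≡ sum xs g
sum-cong []       eq = refl
sum-cong (x ∷ xs) eq = cong₂ _+_ (eq x) (sum-cong xs eq)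

sum-+ : ∀ (xs : List X) (f g : X → ℚ) → sum xs (λ x → f x + g x) ≡ sum xs f + sum xs g
sum-+ []       f g = refl
sum-+ (x ∷ xs) f g = trans (cong (λ a → f x + g x + a) (sum-+ xs f g))
  (solve 4 (λ a b c d → a :+ b :+ (c :+ d) := a :+ c :+ (b :+ d)) refl (f x) (g x) (sum xs f) (sum xs g))

sum-*ˡ : ∀ (xs : List X) c (f : X → ℚ) → sum xs (λ x → c * f x) ≡ c * sum xs f
sum-*ˡ []       c f = sym (ℚ.*-zeroʳ c)
sum-*ˡ (x ∷ xs) c f = trans (cong (c * f x +_) (sum-*ˡ xs c f)) (sym (ℚ.*-distribˡ-+ c (f x) (sum xs f)))

sum-const : ∀ (xs : List X) c → sum xs (λ _ → c) ≡ ι (length xs) * c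
sum-const []       c = sym (trans (cong (_* c) ι0≡0) (ℚ.*-zeroˡ c))
sum-const (x ∷ xs) c = begin
  c + sum xs (λ _ → c)     ≡⟨ cong (c +_) (sum-const xs c) ⟩
  c + ι (length xs) * c    ≡⟨ solve 2 (λ c i → c :+ i :* c := (con 1ℚ :+ i) :* c) refl c (ι (length xs)) ⟩
  (1ℚ + ι (length xs)) * c ≡⟨ cong (_* c) (ι-suc (length xs)) ⟨
  ι (length (x ∷ xs)) * c  ∎
  where open ≡-Reasoning

sum-mono : ∀ (xs : List X) {f g : X → ℚ} → (∀ x → f x ℚ.≤ g x) → sum xs f ℚ.≤ sum xs g
sum-mono []       f≤g = ℚ.≤-refl
sum-mono (x ∷ xs) f≤g = ℚ.+-mono-≤ (f≤g x) (sum-mono xs f≤g)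

sum-swap : ∀ {Y : Set} (xs : List X) (ys : List Y) (f : X → Y → ℚ) →
           sum xs (λ x → sum ys (f x)) ≡ sum ys (λ y → sum xs (λ x → f x y))
sum-swap []       ys f = sym (trans (sum-const ys 0ℚ) (ℚ.*-zeroʳ (ι (length ys))))
sum-swap (x ∷ xs) ys f = trans (cong (sum ys (f x) +_) (sum-swap xs ys f)) (sym (sum-+ ys (f x) _))

-- Tilting a single coordinate.

0<r : ∀ n → 0ℚ ℚ.< r n
0<r n = ℚ.≰⇒> λ r≤0 → ℚ.<-irrefl refl (ℚ.<-≤-trans (positive⁻¹ 1ℚ) (subst₂ ℚ._≤_ (ι*r n) (ℚ.*-zeroʳ (ι (suc n)))
  (ℚ.*-monoˡ-≤-nonNeg (ι (suc n)) {{nonNegative (0≤ι (suc n))}} r≤0)))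

σ : Sign → ℚ
σ Sign.- = - 1ℚ
σ Sign.+ = 1ℚ

σ*σ : ∀ s → σ s * σ s ≡ 1ℚ
σ*σ Sign.- = refl
σ*σ Sign.+ = refl

-- Since h = ε / (K + 1), the nodes t 0, …, t K stop one step before ε, which keeps them strictly
-- inside (−1, 1) even when ε = ±1.
module Tilt (ε : ℚ) (-1≤ε : 0ℚ ℚ.≤ 1ℚ + ε) (ε≤1 : 0ℚ ℚ.≤ 1ℚ - ε) (K : ℕ) where

  h : ℚ
  h = ε * r K

  t v : ℕ → ℚ
  t j = ι j * h
  v j = (1ℚ - t j * t j) ⁻¹

  -- For s = ±1 the i-th increment is 1 - (1 + t (i - 1) s) / (1 + t i s), rewritten with s² = 1 so
  -- as to be affine in s. This form lets averages over points pass inside `drift`.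
  drift : ℕ → ℚ → ℚ
  drift zero    s = 0ℚ
  drift (suc j) s = drift j s + h * (s - t (suc j)) * v (suc j)

  -- `1ℚ + t j * s` is a convex combination of 1 and `1ℚ + ε * s`, in which 1 has weight
  -- `1ℚ - ι j * r K`, at least `r K`.
  0<1+t* : ∀ {j} s → j ℕ.≤ K → 0ℚ ℚ.≤ 1ℚ + ε * s → 0ℚ ℚ.< 1ℚ + t j * s
  0<1+t* {j} s j≤K 0≤1+εs = ℚ.<-≤-trans (0<r K) (begin
    r K
      ≤⟨ 0≤q-p⇒p≤q (subst (0ℚ ℚ.≤_) (solve 2 (λ i ρ →
           con 1ℚ :- (con 1ℚ :+ i) :* ρ := con 1ℚ :- i :* ρ :- ρ) refl (ι j) (r K))
           (p≤q⇒0≤q-p (subst₂ ℚ._≤_ (cong (_* r K) (ι-suc j)) (ι*r K)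
             (ℚ.*-monoʳ-≤-nonNeg (r K) {{nonNegative (0≤r K)}} (ι-mono (ℕ.s≤s j≤K)))))) ⟩
    1ℚ - ι j * r K
      ≡⟨ ℚ.+-identityʳ (1ℚ - ι j * r K) ⟨
    1ℚ - ι j * r K + 0ℚ
      ≤⟨ ℚ.+-monoʳ-≤ (1ℚ - ι j * r K) (0≤* (0≤* (0≤ι j) (0≤r K)) 0≤1+εs) ⟩
    1ℚ - ι j * r K + ι j * r K * (1ℚ + ε * s)
      ≡⟨ solve 4 (λ i ρ ε s → con 1ℚ :- i :* ρ :+ i :* ρ :* (con 1ℚ :+ ε :* s)
           := con 1ℚ :+ i :* (ε :* ρ) :* s) refl (ι j) (r K) ε s ⟩
    1ℚ + t j * s ∎)
    where open ℚ.≤-Reasoning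

  0≤1+εσ : ∀ s → 0ℚ ℚ.≤ 1ℚ + ε * σ s
  0≤1+εσ Sign.- = subst (0ℚ ℚ.≤_)
    (solve 1 (λ ε → con 1ℚ :- ε := con 1ℚ :+ ε :* con (- 1ℚ)) refl ε) ε≤1
  0≤1+εσ Sign.+ = subst (0ℚ ℚ.≤_) (cong (1ℚ +_) (sym (ℚ.*-identityʳ ε))) -1≤ε

  0<1+tσ : ∀ {j} s → j ℕ.≤ K → 0ℚ ℚ.< 1ℚ + t j * σ s
  0<1+tσ s j≤K = 0<1+t* (σ s) j≤K (0≤1+εσ s)

  0<1-tσ : ∀ {j} s → j ℕ.≤ K → 0ℚ ℚ.< 1ℚ - t j * σ s
  0<1-tσ {j} Sign.- j≤K = subst (0ℚ ℚ.<_)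
    (solve 1 (λ t → con 1ℚ :+ t :* con 1ℚ := con 1ℚ :- t :* con (- 1ℚ)) refl (t j)) (0<1+tσ Sign.+ j≤K)
  0<1-tσ {j} Sign.+ j≤K = subst (0ℚ ℚ.<_)
    (solve 1 (λ t → con 1ℚ :+ t :* con (- 1ℚ) := con 1ℚ :- t :* con 1ℚ) refl (t j)) (0<1+tσ Sign.- j≤K)

  0<1-tt : ∀ {j} → j ℕ.≤ K → 0ℚ ℚ.< 1ℚ - t j * t j
  0<1-tt {j} j≤K = subst (0ℚ ℚ.<_)
    (solve 1 (λ t → (con 1ℚ :+ t :* con 1ℚ) :* (con 1ℚ :- t :* con 1ℚ) := con 1ℚ :- t :* t) refl (t j))
    (0<* (0<1+tσ Sign.+ j≤K) (0<1-tσ Sign.+ j≤K))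

  1≤v : ∀ {j} → j ℕ.≤ K → 1ℚ ℚ.≤ v j
  -- `1ℚ ⁻¹` computes to `1ℚ`.
  1≤v {j} j≤K = ⁻¹-anti {q = 1ℚ} (0<1-tt j≤K) (0≤q-p⇒p≤q (subst (0ℚ ℚ.≤_)
    (solve 1 (λ a → a := con 1ℚ :- (con 1ℚ :- a)) refl (t j * t j)) (0≤p*p (t j))))

  -- Scaling by the ratio of consecutive factors lowers the node from `t (suc j)` to `t j` at the
  -- cost of one increment of `drift`. At `t 0`, which is 0, the factor has become 1.
  strip : ∀ j s → j ℕ.≤ K → ∀ {p u} → (1ℚ + t j * σ s) * p ≤exp u → p ≤exp u - drift j (σ s)
  strip zero s _ {p} {u} p≤ = subst₂ _≤exp_
    (trans (cong (λ i → (1ℚ + i * h * σ s) * p) ι0≡0)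
      (solve 3 (λ h s p → (con 1ℚ :+ con 0ℚ :* h :* s) :* p := p) refl h (σ s) p))
    (sym (ℚ.+-identityʳ u)) p≤
  strip (suc j) s j<K {p} {u} p≤ = subst (p ≤exp_)
    (solve 3 (λ u d w → u :+ (con 1ℚ :- w :- con 1ℚ) :- d := u :- (d :+ w))
      refl u (drift j (σ s)) (h * (σ s - t′) * v′))
    (strip j s j≤K (subst (_≤exp u + (ratio - 1ℚ)) telescope (scale ratio 0≤ratio p≤)))
    where
    open ≡-Reasoning
    j≤K = ℕ.<⇒≤ j<K
    t′ = t (suc j)
    v′ = v (suc j)
    x = σ s
    ratio = 1ℚ - h * (x - t′) * v′
    inverse : v′ * (1ℚ - t′ * t′) ≡ 1ℚ
    inverse = ⁻¹-inverseˡ (0<1-tt j<K)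
    t≡ : t j ≡ t′ - h
    t≡ = sym (trans (cong (λ i → i * h - h) (ι-suc j))
      (solve 2 (λ i h → (con 1ℚ :+ i) :* h :- h := i :* h) refl (ι j) h))
    -- Expanding the fraction (1 + t j x) / (1 + t′ x) by 1 - t′ x gives a product of positive
    -- factors, because x² = 1.
    0≤ratio : 0ℚ ℚ.≤ ratio
    0≤ratio = subst (0ℚ ℚ.≤_) (begin
      (1ℚ + t j * x) * (1ℚ - t′ * x) * v′
        ≡⟨ cong (λ a → (1ℚ + a * x) * (1ℚ - t′ * x) * v′) t≡ ⟩
      (1ℚ + (t′ - h) * x) * (1ℚ - t′ * x) * v′
        -- The ring solver cannot use x² = 1, so `1ℚ - x * x` is kept as a factor for `σ*σ` to
        -- cancel.
        ≡⟨ solve 4 (λ t h x v → (con 1ℚ :+ (t :- h) :* x) :* (con 1ℚ :- t :* x) :* v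
             := v :* (con 1ℚ :- t :* t) :- h :* (x :- t) :* v :+ (con 1ℚ :- x :* x) :* (t :* (t :- h) :* v))
             refl t′ h x v′ ⟩
      v′ * (1ℚ - t′ * t′) - h * (x - t′) * v′ + (1ℚ - x * x) * (t′ * (t′ - h) * v′)
        ≡⟨ cong₂ (λ a b → a - h * (x - t′) * v′ + (1ℚ - b) * (t′ * (t′ - h) * v′)) inverse (σ*σ s) ⟩
      ratio + (1ℚ - 1ℚ) * (t′ * (t′ - h) * v′)
        ≡⟨ solve 2 (λ a b → a :+ (con 1ℚ :- con 1ℚ) :* b := a) refl ratio (t′ * (t′ - h) * v′) ⟩
      ratio ∎)
      (0≤* (0≤* (ℚ.<⇒≤ (0<1+tσ s j≤K)) (ℚ.<⇒≤ (0<1-tσ s j<K))) (0≤⁻¹ (0<1-tt j<K)))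
    telescope : ratio * ((1ℚ + t′ * x) * p) ≡ (1ℚ + t j * x) * p
    telescope = begin
      ratio * ((1ℚ + t′ * x) * p)
        ≡⟨ solve 5 (λ t h x v p → (con 1ℚ :- h :* (x :- t) :* v) :* ((con 1ℚ :+ t :* x) :* p)
             := (con 1ℚ :+ t :* x :- h :* x :* (v :* (con 1ℚ :- t :* t)) :+ h :* v :* t :* (con 1ℚ :- x :* x)) :* p)
             refl t′ h x v′ p ⟩
      (1ℚ + t′ * x - h * x * (v′ * (1ℚ - t′ * t′)) + h * v′ * t′ * (1ℚ - x * x)) * p
        ≡⟨ cong₂ (λ a b → (1ℚ + t′ * x - h * x * a + h * v′ * t′ * (1ℚ - b)) * p) inverse (σ*σ s) ⟩
      (1ℚ + t′ * x - h * x * 1ℚ + h * v′ * t′ * (1ℚ - 1ℚ)) * p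
        ≡⟨ solve 5 (λ t h x v p → (con 1ℚ :+ t :* x :- h :* x :* con 1ℚ :+ h :* v :* t :* (con 1ℚ :- con 1ℚ)) :* p
             := (con 1ℚ :+ (t :- h) :* x) :* p) refl t′ h x v′ p ⟩
      (1ℚ + (t′ - h) * x) * p
        ≡⟨ cong (λ a → (1ℚ + a * x) * p) t≡ ⟨
      (1ℚ + t j * x) * p ∎

  -- Since `drift j` is affine, its average depends on `g` only through the mean.
  sum-drift : ∀ j (xs : List X) (g : X → ℚ) → sum xs g ≡ ι (length xs) * ε →
              sum xs (λ x → drift j (g x)) ≡ ι (length xs) * drift j ε
  sum-drift zero    xs g mean = sum-const xs 0ℚ
  sum-drift (suc j) xs g mean = begin
    sum xs (λ x → drift j (g x) + h * (g x - t′) * v′)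
      ≡⟨ sum-+ xs (λ x → drift j (g x)) (λ x → h * (g x - t′) * v′) ⟩
    sum xs (λ x → drift j (g x)) + sum xs (λ x → h * (g x - t′) * v′)
      ≡⟨ cong₂ _+_ (sum-drift j xs g mean) (begin
           sum xs (λ x → h * (g x - t′) * v′)
             ≡⟨ sum-cong xs (λ x → solve 4 (λ h g t v → h :* (g :- t) :* v := h :* v :* (g :+ (:- t)))
                  refl h (g x) t′ v′) ⟩
           sum xs (λ x → h * v′ * (g x + (- t′)))
             ≡⟨ sum-*ˡ xs (h * v′) (λ x → g x + (- t′)) ⟩
           h * v′ * sum xs (λ x → g x + (- t′))
             ≡⟨ cong (h * v′ *_) (sum-+ xs g (λ _ → - t′)) ⟩
           h * v′ * (sum xs g + sum xs (λ _ → - t′))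
             ≡⟨ cong₂ (λ a b → h * v′ * (a + b)) mean (sum-const xs (- t′)) ⟩
           h * v′ * (a * ε + a * (- t′)) ∎) ⟩
    a * drift j ε + h * v′ * (a * ε + a * (- t′))
      ≡⟨ solve 6 (λ a d h v ε t → a :* d :+ h :* v :* (a :* ε :+ a :* (:- t))
           := a :* (d :+ h :* (ε :- t) :* v)) refl a (drift j ε) h v′ ε t′ ⟩
    a * (drift j ε + h * (ε - t′) * v′) ∎
    where
    open ≡-Reasoning
    a = ι (length xs)
    t′ = t (suc j)
    v′ = v (suc j)

  ε≡ : ε ≡ ι (suc K) * h
  ε≡ = sym (trans (solve 3 (λ i ε ρ → i :* (ε :* ρ) := ε :* (i :* ρ)) refl (ι (suc K)) ε (r K))
    (trans (cong (ε *_) (ι*r K)) (ℚ.*-identityʳ ε)))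

  -- Each weight `v i` is at least 1 and `ε - t i` is (K + 1 - i) h, so twice the drift is at least
  -- 2 h² times the sum of K + 1 - i over 1 ≤ i ≤ j, which has this closed form.
  drift-bound : ∀ j → j ℕ.≤ K →
    h * h * (ι j * (ι (suc K) + ι (suc K) - ι j - 1ℚ)) ℚ.≤ drift j ε + drift j ε
  drift-bound zero    _   = ℚ.≤-reflexive (trans
    (cong (λ i → h * h * (i * (ι (suc K) + ι (suc K) - i - 1ℚ))) ι0≡0)
    (solve 2 (λ h n → h :* h :* (con 0ℚ :* (n :+ n :- con 0ℚ :- con 1ℚ)) := con 0ℚ) refl h (ι (suc K))))
  drift-bound (suc j) j<K = begin
    h * h * (ι (suc j) * (n + n - ι (suc j) - 1ℚ))
      ≡⟨ cong (λ i → h * h * (i * (n + n - i - 1ℚ))) (ι-suc j) ⟩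
    h * h * ((1ℚ + i) * (n + n - (1ℚ + i) - 1ℚ))
      ≡⟨ solve 3 (λ h n i → h :* h :* ((con 1ℚ :+ i) :* (n :+ n :- (con 1ℚ :+ i) :- con 1ℚ))
           := h :* h :* (i :* (n :+ n :- i :- con 1ℚ))
              :+ (h :* h :* (n :- (con 1ℚ :+ i)) :+ h :* h :* (n :- (con 1ℚ :+ i)))) refl h n i ⟩
    h * h * (i * (n + n - i - 1ℚ)) + (h * h * (n - (1ℚ + i)) + h * h * (n - (1ℚ + i)))
      ≡⟨ cong (λ a → h * h * (i * (n + n - i - 1ℚ)) + (h * h * (n - a) + h * h * (n - a))) (ι-suc j) ⟨
    h * h * (i * (n + n - i - 1ℚ)) + (c + c)
      ≤⟨ ℚ.+-mono-≤ (drift-bound j (ℕ.<⇒≤ j<K)) (ℚ.+-mono-≤ c≤ c≤) ⟩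
    drift j ε + drift j ε + (h * (ε - t′) * v′ + h * (ε - t′) * v′)
      ≡⟨ solve 2 (λ a b → a :+ a :+ (b :+ b) := a :+ b :+ (a :+ b)) refl (drift j ε) (h * (ε - t′) * v′) ⟩
    drift (suc j) ε + drift (suc j) ε ∎
    where
    open ℚ.≤-Reasoning
    n = ι (suc K)
    i = ι j
    t′ = t (suc j)
    v′ = v (suc j)
    c = h * h * (n - ι (suc j))
    c≡ : c ≡ h * (ε - t′)
    c≡ = trans (solve 3 (λ h n i → h :* h :* (n :- i) := h :* (n :* h :- i :* h)) refl h n (ι (suc j)))
      (cong (λ e → h * (e - t′)) (sym ε≡))
    0≤c : 0ℚ ℚ.≤ c
    0≤c = 0≤* (0≤p*p h) (p≤q⇒0≤q-p (ι-mono (ℕ.m≤n⇒m≤1+n j<K)))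
    c≤ : c ℚ.≤ h * (ε - t′) * v′
    c≤ = begin
      c                    ≡⟨ ℚ.*-identityʳ c ⟨
      c * 1ℚ               ≤⟨ ℚ.*-monoˡ-≤-nonNeg c {{nonNegative 0≤c}} (1≤v j<K) ⟩
      c * v′               ≡⟨ cong (_* v′) c≡ ⟩
      h * (ε - t′) * v′    ∎

  -- At j = K the closed form is h² K (K + 1), and h = ε / (K + 1) turns it into ε² K / (K + 1).
  ε²-bound : ε * ε * (1ℚ - r K) ℚ.≤ drift K ε + drift K ε
  ε²-bound = subst (ℚ._≤ drift K ε + drift K ε) (begin
    h * h * (ι K * (n + n - ι K - 1ℚ))
      ≡⟨ cong (λ a → h * h * (ι K * (a + a - ι K - 1ℚ))) (ι-suc K) ⟩
    h * h * (ι K * ((1ℚ + ι K) + (1ℚ + ι K) - ι K - 1ℚ))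
      ≡⟨ solve 3 (λ ε ρ k → (ε :* ρ) :* (ε :* ρ) :* (k :* ((con 1ℚ :+ k) :+ (con 1ℚ :+ k) :- k :- con 1ℚ))
           := ε :* ε :* (((con 1ℚ :+ k) :* ρ) :* ((con 1ℚ :+ k) :* ρ :- ρ))) refl ε (r K) (ι K) ⟩
    ε * ε * ((1ℚ + ι K) * r K * ((1ℚ + ι K) * r K - r K))
      ≡⟨ cong (λ a → ε * ε * (a * (a - r K))) (trans (cong (_* r K) (sym (ι-suc K))) (ι*r K)) ⟩
    ε * ε * (1ℚ * (1ℚ - r K))
      ≡⟨ cong (ε * ε *_) (ℚ.*-identityˡ (1ℚ - r K)) ⟩
    ε * ε * (1ℚ - r K) ∎)
    (drift-bound K ℕ.≤-refl)
    where
    open ≡-Reasoning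
    n = ι (suc K)

-- Sums over the cube and product densities.

sum-++ : ∀ (xs ys : List X) (f : X → ℚ) → sum (xs ++ ys) f ≡ sum xs f + sum ys f
sum-++ []       ys f = sym (ℚ.+-identityˡ (sum ys f))
sum-++ (x ∷ xs) ys f = trans (cong (f x +_) (sum-++ xs ys f)) (sym (ℚ.+-assoc (f x) _ _))

sum-map : ∀ {Y : Set} (g : X → Y) (xs : List X) (f : Y → ℚ) → sum (map g xs) f ≡ sum xs (f ∘ g)
sum-map g []       f = refl
sum-map g (x ∷ xs) f = cong (f (g x) +_) (sum-map g xs f)

sum-cube : ∀ n (f : Cube (suc n) → ℚ) →
  sum (cube (suc n)) f ≡ sum (cube n) (f ∘ (Sign.- ∷_)) + sum (cube n) (f ∘ (Sign.+ ∷_))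
sum-cube n f = begin
  sum (map (Sign.- ∷_) c ++ (map (Sign.+ ∷_) c ++ [])) f
    ≡⟨ cong (λ l → sum (map (Sign.- ∷_) c ++ l) f) (List.++-identityʳ (map (Sign.+ ∷_) c)) ⟩
  sum (map (Sign.- ∷_) c ++ map (Sign.+ ∷_) c) f
    ≡⟨ sum-++ (map (Sign.- ∷_) c) (map (Sign.+ ∷_) c) f ⟩
  sum (map (Sign.- ∷_) c) f + sum (map (Sign.+ ∷_) c) f
    ≡⟨ cong₂ _+_ (sum-map (Sign.- ∷_) c f) (sum-map (Sign.+ ∷_) c f) ⟩
  sum c (f ∘ (Sign.- ∷_)) + sum c (f ∘ (Sign.+ ∷_)) ∎
  where
  open ≡-Reasoning
  c = cube n

ι-2* : ∀ m → ι m + ι m ≡ ι (2 ℕ.* m)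
ι-2* m = trans (sym (ι-+ m m)) (cong (λ k → ι (m ℕ.+ k)) (sym (ℕ.+-identityʳ m)))

sum-cube-1 : ∀ n → sum (cube n) (λ _ → 1ℚ) ≡ ι (2 ℕ.^ n)
sum-cube-1 zero    = sym (trans (ι-suc 0) (cong (1ℚ +_) ι0≡0))
sum-cube-1 (suc n) = trans (sum-cube n (λ _ → 1ℚ))
  (trans (cong₂ _+_ (sum-cube-1 n) (sum-cube-1 n)) (ι-2* (2 ℕ.^ n)))

product-weight : ∀ {n} → (Fin n → ℚ) → Cube n → ℚ
product-weight {n} t x = prod (allFin n) λ i → 1ℚ + t i * σ (lookup x i)

product-weight-∷ : ∀ {n} (t : Fin (suc n) → ℚ) s x →
  product-weight t (s ∷ x) ≡ (1ℚ + t zero * σ s) * product-weight (t ∘ suc) x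
product-weight-∷ {n} t s x = cong (λ l → (1ℚ + t zero * σ s) * foldr _*_ 1ℚ l)
  (trans (List.map-tabulate {n = n} suc f) (sym (List.map-tabulate {n = n} id (f ∘ suc))))
  where
  f : Fin (suc n) → ℚ
  f i = 1ℚ + t i * σ (lookup (s ∷ x) i)

-- The two signs of the first coordinate contribute 1 - t and 1 + t, so each coordinate gives a
-- factor 2 whatever its tilt.
sum-product-weight : ∀ n (t : Fin n → ℚ) → sum (cube n) (product-weight t) ≡ ι (2 ℕ.^ n)
sum-product-weight zero    t = sym (trans (ι-suc 0) (cong (1ℚ +_) ι0≡0))
sum-product-weight (suc n) t = begin
  sum (cube (suc n)) (product-weight t)
    ≡⟨ sum-cube n (product-weight t) ⟩
  sum c (λ x → product-weight t (Sign.- ∷ x)) + sum c (λ x → product-weight t (Sign.+ ∷ x))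
    ≡⟨ cong₂ _+_ (slice Sign.-) (slice Sign.+) ⟩
  (1ℚ + t zero * - 1ℚ) * W + (1ℚ + t zero * 1ℚ) * W
    ≡⟨ solve 2 (λ t w → (con 1ℚ :+ t :* con (- 1ℚ)) :* w :+ (con 1ℚ :+ t :* con 1ℚ) :* w := w :+ w)
         refl (t zero) W ⟩
  W + W
    ≡⟨ cong₂ _+_ (sum-product-weight n (t ∘ suc)) (sum-product-weight n (t ∘ suc)) ⟩
  ι (2 ℕ.^ n) + ι (2 ℕ.^ n)
    ≡⟨ ι-2* (2 ℕ.^ n) ⟩
  ι (2 ℕ.^ suc n) ∎
  where
  open ≡-Reasoning
  c = cube n
  W = sum c (product-weight (t ∘ suc))
  slice : ∀ s → sum c (λ x → product-weight t (s ∷ x)) ≡ (1ℚ + t zero * σ s) * W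
  slice s = trans (sum-cong c (product-weight-∷ t s))
    (sum-*ˡ c (1ℚ + t zero * σ s) (product-weight (t ∘ suc)))

-- The Gibbs inequality for a nonempty set of points.

0≤prod : ∀ (xs : List X) (f : X → ℚ) → (∀ x → 0ℚ ℚ.≤ f x) → 0ℚ ℚ.≤ prod xs f
0≤prod []       f 0≤f = 0≤1ℚ
0≤prod (x ∷ xs) f 0≤f = 0≤* (0≤f x) (0≤prod xs f 0≤f)

degree-1-sum : ∀ {n} → List (Cube n) → Fin n → ℚ
degree-1-sum xs i = sum xs λ x → σ (lookup x i)

±σ : ∀ s → 0ℚ ℚ.≤ 1ℚ + σ s × 0ℚ ℚ.≤ 1ℚ - σ s
±σ Sign.- = ℚ.≤-refl , ℚ.nonNegative⁻¹ (1ℚ + 1ℚ)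
±σ Sign.+ = ℚ.nonNegative⁻¹ (1ℚ + 1ℚ) , ℚ.≤-refl

0≤sum : ∀ (xs : List X) (f : X → ℚ) → (∀ x → 0ℚ ℚ.≤ f x) → 0ℚ ℚ.≤ sum xs f
0≤sum []       f 0≤f = ℚ.≤-refl
0≤sum (x ∷ xs) f 0≤f = ℚ.+-mono-≤ (0≤f x) (0≤sum xs f 0≤f)

-- `y` stands for the inverse density and `R` for the Riemann sum of its logarithm. The head `x₀` is
-- split off so that `r (length xs₀)` is 1 over the number of points. Inclusion in the cube, with
-- multiplicity, is expressed by domination of sums of nonnegative functions.
module Gibbs {n : ℕ} (x₀ : Cube n) (xs₀ : List (Cube n)) (K : ℕ) (α y R : ℚ)
  (0≤α : 0ℚ ℚ.≤ α) (αy≡1 : α * y ≡ 1ℚ) (α≡ : α * ι (2 ℕ.^ n) ≡ ι (suc (length xs₀))) (y≤ : y ≤exp R)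
  (xs⊆cube : ∀ (f : Cube n → ℚ) → (∀ x → 0ℚ ℚ.≤ f x) → sum (x₀ ∷ xs₀) f ℚ.≤ sum (cube n) f) where

  xs : List (Cube n)
  xs = x₀ ∷ xs₀

  a : ℚ
  a = ι (length xs)

  instance
    a-pos : ℚ.Positive a
    a-pos = positive (ℚ.<-≤-trans (positive⁻¹ 1ℚ) (subst₂ ℚ._≤_ (ℚ.+-identityʳ 1ℚ)
      (sym (ι-suc (length xs₀))) (ℚ.+-monoʳ-≤ 1ℚ (0≤ι (length xs₀)))))

  ε : Fin n → ℚ
  ε i = degree-1-sum xs i * r (length xs₀)

  mean : ∀ i → degree-1-sum xs i ≡ a * ε i
  mean i = sym (trans (solve 3 (λ a s ρ → a :* (s :* ρ) := s :* (a :* ρ)) refl a (degree-1-sum xs i) (r (length xs₀)))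
    (trans (cong (degree-1-sum xs i *_) (ι*r (length xs₀))) (ℚ.*-identityʳ (degree-1-sum xs i))))

  -1≤ε : ∀ i → 0ℚ ℚ.≤ 1ℚ + ε i
  -1≤ε i = ℚ.*-cancelˡ-≤-pos a (begin
    a * 0ℚ                              ≡⟨ ℚ.*-zeroʳ a ⟩
    0ℚ                                  ≤⟨ 0≤sum xs _ (λ x → proj₁ (±σ (lookup x i))) ⟩
    sum xs (λ x → 1ℚ + σ (lookup x i))  ≡⟨ sum-+ xs (λ _ → 1ℚ) (λ x → σ (lookup x i)) ⟩
    sum xs (λ _ → 1ℚ) + degree-1-sum xs i ≡⟨ cong₂ _+_ (sum-const xs 1ℚ) (mean i) ⟩
    a * 1ℚ + a * ε i                    ≡⟨ ℚ.*-distribˡ-+ a 1ℚ (ε i) ⟨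
    a * (1ℚ + ε i)                      ∎)
    where open ℚ.≤-Reasoning

  ε≤1 : ∀ i → 0ℚ ℚ.≤ 1ℚ - ε i
  ε≤1 i = ℚ.*-cancelˡ-≤-pos a (begin
    a * 0ℚ                              ≡⟨ ℚ.*-zeroʳ a ⟩
    0ℚ                                  ≤⟨ 0≤sum xs _ (λ x → proj₂ (±σ (lookup x i))) ⟩
    sum xs (λ x → 1ℚ - σ (lookup x i))
      ≡⟨ sum-cong xs (λ x → solve 1 (λ s → con 1ℚ :- s := con 1ℚ :+ con (- 1ℚ) :* s) refl (σ (lookup x i))) ⟩
    sum xs (λ x → 1ℚ + - 1ℚ * σ (lookup x i))
      ≡⟨ sum-+ xs (λ _ → 1ℚ) (λ x → - 1ℚ * σ (lookup x i)) ⟩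
    sum xs (λ _ → 1ℚ) + sum xs (λ x → - 1ℚ * σ (lookup x i))
      ≡⟨ cong₂ _+_ (sum-const xs 1ℚ) (trans (sum-*ˡ xs (- 1ℚ) (λ x → σ (lookup x i))) (cong (- 1ℚ *_) (mean i))) ⟩
    a * 1ℚ + - 1ℚ * (a * ε i)
      ≡⟨ solve 2 (λ a e → a :* con 1ℚ :+ con (- 1ℚ) :* (a :* e) := a :* (con 1ℚ :- e)) refl a (ε i) ⟩
    a * (1ℚ - ε i)                      ∎)
    where open ℚ.≤-Reasoning

  module T (i : Fin n) = Tilt (ε i) (-1≤ε i) (ε≤1 i) K

  W : Cube n → ℚ
  W = product-weight λ i → T.t i K

  0≤W : ∀ x → 0ℚ ℚ.≤ W x
  0≤W x = 0≤prod (allFin n) _ λ i → ℚ.<⇒≤ (T.0<1+tσ i (lookup x i) ℕ.≤-refl)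

  drift : Fin n → ℚ → ℚ
  drift i = T.drift i K

  strip-all : ∀ (x : Cube n) is {p u} →
    prod is (λ i → 1ℚ + T.t i K * σ (lookup x i)) * p ≤exp u →
    p ≤exp u - sum is (λ i → drift i (σ (lookup x i)))
  strip-all x []       {p} {u} p≤ = subst₂ _≤exp_ (ℚ.*-identityˡ p) (sym (ℚ.+-identityʳ u)) p≤
  strip-all x (i ∷ is) {p} {u} p≤ = subst (p ≤exp_)
    (solve 3 (λ u a b → u :- a :- b := u :- (a :+ b)) refl u (drift i (σ (lookup x i))) _)
    (strip-all x is (T.strip i K (lookup x i) ℕ.≤-refl (subst (_≤exp u)
      (ℚ.*-assoc (1ℚ + T.t i K * σ (lookup x i)) (prod is _) p) p≤)))

  D : Cube n → ℚ
  D x = sum (allFin n) λ i → drift i (σ (lookup x i))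

  -- Scaling the certificate for `y` by `α * W x` gives one for `W x`, because `α * y` is 1.
  -- Stripping all factors of `W x` leaves 1, so the total exponent is nonnegative.
  pointwise : ∀ x → D x ℚ.≤ R + (α * W x - 1ℚ)
  pointwise x = 0≤q-p⇒p≤q (1≤exp⇒0≤ (strip-all x (allFin n) (subst (_≤exp R + (α * W x - 1ℚ))
    (trans (solve 3 (λ α w y → α :* w :* y := w :* (α :* y)) refl α (W x) y) (cong (W x *_) αy≡1))
    (scale (α * W x) (0≤* 0≤α (0≤W x)) y≤))))

  sum-drift≤R : sum (allFin n) (λ i → drift i (ε i)) ℚ.≤ R
  sum-drift≤R = ℚ.*-cancelˡ-≤-pos a (begin
    a * sum (allFin n) (λ i → drift i (ε i))
      ≡⟨ sum-*ˡ (allFin n) a (λ i → drift i (ε i)) ⟨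
    sum (allFin n) (λ i → a * drift i (ε i))
      ≡⟨ sum-cong (allFin n) (λ i → sym (T.sum-drift i K xs (λ x → σ (lookup x i)) (mean i))) ⟩
    sum (allFin n) (λ i → sum xs (λ x → drift i (σ (lookup x i))))
      ≡⟨ sum-swap (allFin n) xs (λ i x → drift i (σ (lookup x i))) ⟩
    sum xs D
      ≤⟨ sum-mono xs pointwise ⟩
    sum xs (λ x → R + (α * W x - 1ℚ))
      ≡⟨ sum-cong xs (λ x → solve 2 (λ b c → b :+ (c :- con 1ℚ) := b :- con 1ℚ :+ c) refl R (α * W x)) ⟩
    sum xs (λ x → R - 1ℚ + α * W x)
      ≡⟨ sum-+ xs (λ _ → R - 1ℚ) (λ x → α * W x) ⟩
    sum xs (λ _ → R - 1ℚ) + sum xs (λ x → α * W x)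
      ≡⟨ cong₂ _+_ (sum-const xs (R - 1ℚ)) (sum-*ˡ xs α W) ⟩
    a * (R - 1ℚ) + α * sum xs W
      -- Extending the sum of `W` to the whole cube makes it `ι (2 ℕ.^ n)`; times `α` this is `a`,
      -- which cancels the -1 of every point.
      ≤⟨ ℚ.+-monoʳ-≤ (a * (R - 1ℚ)) (ℚ.*-monoˡ-≤-nonNeg α {{nonNegative 0≤α}} (xs⊆cube W 0≤W)) ⟩
    a * (R - 1ℚ) + α * sum (cube n) W
      ≡⟨ cong (λ z → a * (R - 1ℚ) + z) (trans (cong (α *_) (sum-product-weight n (λ i → T.t i K))) α≡) ⟩
    a * (R - 1ℚ) + a
      ≡⟨ solve 2 (λ a b → a :* (b :- con 1ℚ) :+ a := a :* b) refl a R ⟩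
    a * R ∎)
    where open ℚ.≤-Reasoning

  sum-ε² : ℚ
  sum-ε² = sum (allFin n) λ i → ε i * ε i

  -- The doubling in `ε²-bound` is the source of the constant 2 of the theorem.
  level-1 : sum-ε² * (1ℚ - r K) ℚ.≤ R + R
  level-1 = begin
    sum-ε² * (1ℚ - r K)
      ≡⟨ ℚ.*-comm sum-ε² (1ℚ - r K) ⟩
    (1ℚ - r K) * sum-ε²
      ≡⟨ sum-*ˡ (allFin n) (1ℚ - r K) (λ i → ε i * ε i) ⟨
    sum (allFin n) (λ i → (1ℚ - r K) * (ε i * ε i))
      ≡⟨ sum-cong (allFin n) (λ i → ℚ.*-comm (1ℚ - r K) (ε i * ε i)) ⟩
    sum (allFin n) (λ i → ε i * ε i * (1ℚ - r K))
      ≤⟨ sum-mono (allFin n) (λ i → T.ε²-bound i) ⟩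
    sum (allFin n) (λ i → drift i (ε i) + drift i (ε i))
      ≡⟨ sum-+ (allFin n) _ _ ⟩
    sum (allFin n) (λ i → drift i (ε i)) + sum (allFin n) (λ i → drift i (ε i))
      ≤⟨ ℚ.+-mono-≤ sum-drift≤R sum-drift≤R ⟩
    R + R ∎
    where open ℚ.≤-Reasoning

-- Real expressions as sequences of rationals.

seq-∑ : ∀ (xs : List X) (f : X → ℝ) k → seq (∑ xs f) k ≡ sum xs (λ x → seq (f x) k)
seq-∑ []       f k = refl
seq-∑ (x ∷ xs) f k = cong (seq (f x) k +_) (seq-∑ xs f k)

seq-±1 : ∀ s k → seq (±1 s) k ≡ σ s
seq-±1 Sign.- k = refl
seq-±1 Sign.+ k = refl

seq-ln : ∀ {y} k → 0ℚ ℚ.< y → seq (ln y) k ≡ riemann _⁻¹ 1ℚ y (suc k)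
seq-ln {y} k 0<y with 0ℚ ℚ.<? y
... | yes _   = refl
... | no  0≮y = contradiction 0<y 0≮y

-- A general `g` lets the recursion pass to `g ∘ suc`. With `g = id` it reduces the character of a
-- singleton to one factor.
filter-tabulate-unique : ∀ {n} {P : Pred X 0ℓ} (P? : Decidable P) (g : Fin n → X) i →
  P (g i) → (∀ j → P (g j) → j ≡ i) → filter P? (tabulate g) ≡ g i ∷ []
filter-tabulate-unique P? g zero Pi unique = trans (List.filter-accept P? Pi)
  (cong (g zero ∷_) (List.filter-none P? (All.tabulate⁺ λ j Pj → Fin.0≢1+n (sym (unique (suc j) Pj)))))
filter-tabulate-unique P? g (suc i) Pi unique = trans
  (List.filter-reject P? λ P0 → Fin.0≢1+n (unique zero P0))
  (filter-tabulate-unique P? (g ∘ suc) i Pi λ j Pj → Fin.suc-injective (unique (suc j) Pj))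

seq-χ-singleton : ∀ {n} (i : Fin n) x k → seq (χ ⁅ i ⁆ x) k ≡ σ (lookup x i)
seq-χ-singleton {n} i x k = begin
  seq (∏ (filter (_∈? ⁅ i ⁆) (allFin n)) (λ j → ±1 (lookup x j))) k
    ≡⟨ cong (λ l → seq (∏ l (λ j → ±1 (lookup x j))) k)
         (filter-tabulate-unique (_∈? ⁅ i ⁆) id i (x∈⁅x⁆ i) (λ j → x∈⁅y⁆⇒x≡y i)) ⟩
  seq (±1 (lookup x i)) k * 1ℚ
    ≡⟨ ℚ.*-identityʳ (seq (±1 (lookup x i)) k) ⟩
  seq (±1 (lookup x i)) k
    ≡⟨ seq-±1 (lookup x i) k ⟩
  σ (lookup x i) ∎
  where open ≡-Reasoning

/≡ι* : ∀ k m .{{_ : ℕ.NonZero m}} → ℤ.+ k / m ≡ ι k * (ℤ.+ 1 / m)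
/≡ι* k (suc m) = trans (/≡ι*r k m) (cong (ι k *_) (sym (r≡ m)))

ι*1/ : ∀ m .{{_ : ℕ.NonZero m}} → ι m * (ℤ.+ 1 / m) ≡ 1ℚ
ι*1/ (suc m) = trans (cong (ι (suc m) *_) (r≡ m)) (ι*r m)

0≤1/ : ∀ m .{{_ : ℕ.NonZero m}} → 0ℚ ℚ.≤ ℤ.+ 1 / m
0≤1/ (suc m) = subst (0ℚ ℚ.≤_) (sym (r≡ m)) (0≤r m)

-- Abstract because conversion checking otherwise unfolds the normalised fraction.
abstract
  2^- : ℕ → ℚ
  2^- n = (ℤ.+ 1 / 2 ℕ.^ n) {{ℕ.m^n≢0 2 n}}

  2^-≡ : ∀ n → (ℤ.+ 1 / 2 ℕ.^ n) {{ℕ.m^n≢0 2 n}} ≡ 2^- n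
  2^-≡ n = refl

  ι2^*2^- : ∀ n → ι (2 ℕ.^ n) * 2^- n ≡ 1ℚ
  ι2^*2^- n = ι*1/ (2 ℕ.^ n) {{ℕ.m^n≢0 2 n}}

  0≤2^- : ∀ n → 0ℚ ℚ.≤ 2^- n
  0≤2^- n = 0≤1/ (2 ℕ.^ n) {{ℕ.m^n≢0 2 n}}

seq-*ℝ : ∀ x y k → seq (x *ℝ y) k ≡ seq x k * seq y k
seq-*ℝ x y k = refl

-- With a variable `q` the equation holds by matching on `refl`, so the normalised fraction can be
-- exchanged for `2^- n` without being unfolded.
fourier≡ : ∀ {n} (f : Cube n → ℝ) S q → (ℤ.+ 1 / 2 ℕ.^ n) {{ℕ.m^n≢0 2 n}} ≡ q →
           fourier f S ≡ fromℚ q *ℝ ∑ (cube n) (λ x → f x *ℝ χ S x)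
fourier≡ f S q refl = refl

seq-fourier : ∀ {n} (f : Cube n → ℝ) S k →
  seq (fourier f S) k ≡ 2^- n * sum (cube n) (λ x → seq (f x) k * seq (χ S x) k)
seq-fourier {n} f S k = begin
  seq (fourier f S) k
    ≡⟨ cong (λ z → seq z k) (fourier≡ {n} f S (2^- n) (2^-≡ n)) ⟩
  seq (fromℚ (2^- n) *ℝ ∑ (cube n) (λ x → f x *ℝ χ S x)) k
    ≡⟨ seq-*ℝ (fromℚ (2^- n)) (∑ (cube n) (λ x → f x *ℝ χ S x)) k ⟩
  2^- n * seq (∑ (cube n) (λ x → f x *ℝ χ S x)) k
    ≡⟨ cong (2^- n *_) (seq-∑ (cube n) (λ x → f x *ℝ χ S x) k) ⟩
  2^- n * sum (cube n) (λ x → seq (f x *ℝ χ S x) k)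
    ≡⟨ cong (2^- n *_) (sum-cong (cube n) (λ x → seq-*ℝ (f x) (χ S x) k)) ⟩
  2^- n * sum (cube n) (λ x → seq (f x) k * seq (χ S x) k) ∎
  where open ≡-Reasoning

module _ {n} {A : Pred (Cube n) 0ℓ} (A? : Decidable A) where

  sum-indicator : ∀ xs (g : Cube n → ℚ) k →
    sum xs (λ x → seq (indicator A? x) k * g x) ≡ sum (filter A? xs) g
  sum-indicator []       g k = refl
  sum-indicator (x ∷ xs) g k with A? x
  ... | yes _ = cong₂ _+_ (ℚ.*-identityˡ (g x)) (sum-indicator xs g k)
  ... | no  _ = trans (cong₂ _+_ (ℚ.*-zeroˡ (g x)) (sum-indicator xs g k)) (ℚ.+-identityˡ _)

  sum-filter≤ : ∀ xs (g : Cube n → ℚ) → (∀ x → 0ℚ ℚ.≤ g x) → sum (filter A? xs) g ℚ.≤ sum xs g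
  sum-filter≤ []       g 0≤g = ℚ.≤-refl
  sum-filter≤ (x ∷ xs) g 0≤g with A? x
  ... | yes _ = ℚ.+-monoʳ-≤ (g x) (sum-filter≤ xs g 0≤g)
  ... | no  _ = subst (ℚ._≤ g x + sum xs g) (ℚ.+-identityˡ _) (ℚ.+-mono-≤ (0≤g x) (sum-filter≤ xs g 0≤g))

  seq-fourier-singleton : ∀ i k → seq (fourier {n} (indicator {n} {A} A?) ⁅ i ⁆) k
    ≡ 2^- n * degree-1-sum (filter A? (cube n)) i
  seq-fourier-singleton i k = trans (seq-fourier {n} (indicator {n} {A} A?) ⁅ i ⁆ k)
    (cong (2^- n *_) (trans
      (sum-cong (cube n) λ x → cong (seq (indicator A? x) k *_) (seq-χ-singleton i x k))
      (sum-indicator (cube n) (λ x → σ (lookup x i)) k)))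

  density≡ : density A? ≡ ι (length (filter A? (cube n))) * 2^- n
  density≡ = trans (/≡ι* (length (filter A? (cube n))) (2 ℕ.^ n) {{ℕ.m^n≢0 2 n}})
    (cong (ι (length (filter A? (cube n))) *_) (2^-≡ n))

-- The inequality at each index of the sequences.

-- The only loss, from the factor `1ℚ - r K` of the Gibbs bound, falls below any δ once K is large.
level-1-inequality : ∀ {n} (xs : List (Cube n)) →
  (∀ (f : Cube n → ℚ) → (∀ x → 0ℚ ℚ.≤ f x) → sum xs f ℚ.≤ sum (cube n) f) →
  let α = ι (length xs) * 2^- n
      F = λ i → 2^- n * degree-1-sum xs i
  in ∀ k δ → 0ℚ ℚ.< δ →
     sum (allFin n) (λ i → F i * F i) ℚ.≤ (1ℚ + 1ℚ) * (α * α) * seq (ln (α ⁻¹)) k + δ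
-- Here the density is 0 and annihilates the logarithm, whatever its value.
level-1-inequality {n} [] xs⊆cube k δ 0<δ = begin
  sum (allFin n) (λ i → 2^- n * 0ℚ * (2^- n * 0ℚ))
    ≡⟨ sum-cong (allFin n) (λ i → solve 1 (λ q → q :* con 0ℚ :* (q :* con 0ℚ) := con 0ℚ) refl (2^- n)) ⟩
  sum (allFin n) (λ i → 0ℚ)
    ≡⟨ trans (sum-const (allFin n) 0ℚ) (ℚ.*-zeroʳ (ι (length (allFin n)))) ⟩
  0ℚ
    ≤⟨ ℚ.<⇒≤ 0<δ ⟩
  δ
    ≡⟨ solve 3 (λ q L δ → δ := (con 1ℚ :+ con 1ℚ) :* (con 0ℚ :* q :* (con 0ℚ :* q)) :* L :+ δ)
         refl (2^- n) L δ ⟩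
  (1ℚ + 1ℚ) * (0ℚ * 2^- n * (0ℚ * 2^- n)) * L + δ
    ≡⟨ cong (λ z → (1ℚ + 1ℚ) * (z * 2^- n * (z * 2^- n)) * L + δ) ι0≡0 ⟨
  (1ℚ + 1ℚ) * (ι 0 * 2^- n * (ι 0 * 2^- n)) * L + δ ∎
  where
  open ℚ.≤-Reasoning
  L = seq (ln ((ι 0 * 2^- n) ⁻¹)) k
level-1-inequality {n} xs@(x₀ ∷ xs₀) xs⊆cube k δ 0<δ = begin
  sum (allFin n) (λ i → F i * F i)
    ≡⟨ sum-cong (allFin n) (λ i → trans (cong (λ s → q * s * (q * s)) (G.mean i))
         (solve 3 (λ q a e → q :* (a :* e) :* (q :* (a :* e)) := a :* q :* (a :* q) :* (e :* e))
           refl q a (G.ε i))) ⟩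
  sum (allFin n) (λ i → α * α * (G.ε i * G.ε i))
    ≡⟨ sum-*ˡ (allFin n) (α * α) (λ i → G.ε i * G.ε i) ⟩
  α * α * S
    ≡⟨ solve 3 (λ b s ρ → b :* s := b :* (s :* (con 1ℚ :- ρ)) :+ b :* s :* ρ) refl (α * α) S (r K) ⟩
  α * α * (S * (1ℚ - r K)) + α * α * S * r K
    ≤⟨ ℚ.+-mono-≤ (ℚ.*-monoˡ-≤-nonNeg (α * α) {{nonNegative (0≤* 0≤α 0≤α)}} G.level-1) αα-small ⟩
  α * α * (R + R) + δ
    ≡⟨ cong (_+ δ) (solve 2 (λ b R → b :* (R :+ R) := (con 1ℚ :+ con 1ℚ) :* b :* R) refl (α * α) R) ⟩
  (1ℚ + 1ℚ) * (α * α) * R + δ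
    ≡⟨ cong (λ z → (1ℚ + 1ℚ) * (α * α) * z + δ) (seq-ln k (ℚ.<-≤-trans (positive⁻¹ 1ℚ) 1≤y)) ⟨
  (1ℚ + 1ℚ) * (α * α) * seq (ln y) k + δ ∎
  where
  open ℚ.≤-Reasoning
  q = 2^- n
  a = ι (length xs)
  α = a * q
  y = α ⁻¹
  R = riemann _⁻¹ 1ℚ y (suc k)
  F : Fin n → ℚ
  F i = q * degree-1-sum xs i
  q*2^n : ι (2 ℕ.^ n) * q ≡ 1ℚ
  q*2^n = ι2^*2^- n
  0≤q : 0ℚ ℚ.≤ q
  0≤q = 0≤2^- n
  0≤α : 0ℚ ℚ.≤ α
  0≤α = 0≤* (0≤ι (length xs)) 0≤q
  α*2^n : α * ι (2 ℕ.^ n) ≡ a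
  α*2^n = trans (solve 3 (λ a q N → a :* q :* N := a :* (N :* q)) refl a q (ι (2 ℕ.^ n)))
    (trans (cong (a *_) q*2^n) (ℚ.*-identityʳ a))
  0<α : 0ℚ ℚ.< α
  0<α = ℚ.≰⇒> λ α≤0 → ℚ.<-irrefl refl (ℚ.<-≤-trans (positive⁻¹ 1ℚ) (begin
    1ℚ                      ≡⟨ ℚ.+-identityʳ 1ℚ ⟨
    1ℚ + 0ℚ                 ≤⟨ ℚ.+-monoʳ-≤ 1ℚ (0≤ι (length xs₀)) ⟩
    1ℚ + ι (length xs₀)     ≡⟨ ι-suc (length xs₀) ⟨
    a                       ≡⟨ α*2^n ⟨
    α * ι (2 ℕ.^ n)         ≤⟨ ℚ.*-monoʳ-≤-nonNeg (ι (2 ℕ.^ n)) {{nonNegative (0≤ι (2 ℕ.^ n))}} α≤0 ⟩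
    0ℚ * ι (2 ℕ.^ n)        ≡⟨ ℚ.*-zeroˡ (ι (2 ℕ.^ n)) ⟩
    0ℚ                      ∎))
  α≤1 : α ℚ.≤ 1ℚ
  α≤1 = begin
    a * q                       ≡⟨ cong (_* q) (trans (sum-const xs 1ℚ) (ℚ.*-identityʳ a)) ⟨
    sum xs (λ _ → 1ℚ) * q       ≤⟨ ℚ.*-monoʳ-≤-nonNeg q {{nonNegative 0≤q}} (xs⊆cube (λ _ → 1ℚ) (λ _ → 0≤1ℚ)) ⟩
    sum (cube n) (λ _ → 1ℚ) * q ≡⟨ cong (_* q) (sum-cube-1 n) ⟩
    ι (2 ℕ.^ n) * q             ≡⟨ q*2^n ⟩
    1ℚ                          ∎
  1≤y : 1ℚ ℚ.≤ y
  1≤y = ⁻¹-anti {q = 1ℚ} 0<α α≤1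
  -- This is `G.sum-ε²` spelled out: `K` is chosen from it, and `G` takes `K` as a parameter.
  S = sum (allFin n) λ i → let e = degree-1-sum xs i * r (length xs₀) in e * e
  K = proj₁ (K*r-small (α * α * S) δ 0<δ)
  αα-small : α * α * S * r K ℚ.≤ δ
  αα-small = proj₂ (K*r-small (α * α * S) δ 0<δ) K ℕ.≤-refl
  module G = Gibbs x₀ xs₀ K α y R 0≤α (trans (ℚ.*-comm α y) (⁻¹-inverseˡ 0<α)) α*2^n
    (≤exp-riemann y k 1≤y) xs⊆cube

-- Passage to the reals.

-- The inequality holds at every index for every δ, so 0 serves as the threshold.
≤ℝ-intro : ∀ x y (p q : ℕ → ℚ) → (∀ k → seq x k ≡ p k) → (∀ k → seq y k ≡ q k) →
           (∀ k δ → 0ℚ ℚ.< δ → p k ℚ.≤ q k + δ) → x ≤ℝ y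
≤ℝ-intro x y p q x≡p y≡q p≤q δ 0<δ = 0 , λ k _ →
  subst₂ (λ a b → a ℚ.≤ b + δ) (sym (x≡p k)) (sym (y≡q k)) (p≤q k δ 0<δ)

seq-∑-² : ∀ (xs : List X) (f : X → ℝ) (g : X → ℚ) k → (∀ x → seq (f x) k ≡ g x) →
          seq (∑ xs (λ x → f x ²)) k ≡ sum xs (λ x → g x * g x)
seq-∑-² xs f g k f≡g = trans (seq-∑ xs (λ x → f x ²) k)
  (sum-cong xs λ x → trans (seq-*ℝ (f x) (f x) k) (cong (λ s → s * s) (f≡g x)))

seq-level-1-bound : ∀ α β k → α ≡ β →
  seq (fromℚ (1ℚ + 1ℚ) *ℝ fromℚ α ² *ℝ ln (α ⁻¹)) k ≡ (1ℚ + 1ℚ) * (β * β) * seq (ln (β ⁻¹)) k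
seq-level-1-bound α β k refl = refl

theorem1 : (n : ℕ) → 1 ≤ n →
    (A : Pred (Cube n) 0ℓ) (A? : Decidable A) →
    let α = density A?
        f = indicator A?
    in ∑ (allFin n) (λ i → fourier f ⁅ i ⁆ ²)
         ≤ℝ fromℚ (1ℚ + 1ℚ) *ℝ fromℚ α ² *ℝ ln (α ⁻¹)
theorem1 n _ A A? = ≤ℝ-intro
  (∑ (allFin n) (λ i → fourier {n} (indicator {n} {A} A?) ⁅ i ⁆ ²))
  (fromℚ (1ℚ + 1ℚ) *ℝ fromℚ α ² *ℝ ln (α ⁻¹))
  -- The Fourier coefficients are rational, so this side is a constant sequence.
  (λ _ → sum (allFin n) λ i → F i * F i)
  (λ k → (1ℚ + 1ℚ) * (β * β) * seq (ln (β ⁻¹)) k)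
  (λ k → seq-∑-² (allFin n) (λ i → fourier {n} (indicator {n} {A} A?) ⁅ i ⁆) F k
    (λ i → seq-fourier-singleton {n} {A} A? i k))
  (λ k → seq-level-1-bound α β k (density≡ A?))
  (level-1-inequality xs (sum-filter≤ A? (cube n)))
  where
  xs = filter A? (cube n)
  α = density {n} {A} A?
  β = ι (length xs) * 2^- n
  F : Fin n → ℚ
  F i = 2^- n * degree-1-sum xs i
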